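{- Consider the divisible coflow scheduling problem with arbitrary release times on $m\ge 2$ identical parallel network cores. The algorithm flow-driven-list-scheduling (defined in the context) has approximation ratio at most $6-\frac{2}{m}$. That is, for every instance, the schedule it produces has coflow completion times $\tilde C_k$ ($k\in\mathcal K$) satisfying $$\sum_{k\in\mathcal K} w_k\tilde C_k\le\left(6-\frac{2}{m}\right)\mathrm{OPT},$$ where $\mathrm{OPT}$ is the minimum of $\sum_{k\in\mathcal K} w_kC_k$ over all feasible divisible schedules of the instance.
   Context: Network: there are $m$ identical cores $h=1,\dots,m$. Each core is a non-blocking $N\times N$ switch with input ports $\mathcal I=\{1,\dots,N\}$ and output ports $\mathcal J=\{1,\dots,N\}$. Every port of every core has capacity (rate) $1$. Instance: a finite set $\mathcal K$ of coflows. Coflow $k$ has a release time $r_k\ge 0$, a weight $w_k>0$, and a demand matrix $(d_{ijk})_{i,j=1}^N$ of non-negative integers. Each triple $(i,j,k)$ with $d_{ijk}>0$ is a flow of size $d_{ijk}$ that must be sent from input $i$ to output $j$, and not before time $r_k$. Feasible divisible schedule: each flow is assigned to exactly one core, and all its data are transmitted through that core. Different flows of one coflow may use different cores. Preemption is allowed. At any time, on each core, the total transmission rate through each input port and through each output port is at most $1$. The completion time $C_k$ of coflow $k$ is the time at which all its flows are finished (with $C_k=r_k$ if it has no flows). The objective is to minimize $\sum_{k}w_kC_k$. Linear program: let $\mathcal K_i=\{(k,j): d_{ijk}>0\}$ for an input $i$, and $\mathcal K_j=\{(k,i): d_{ijk}>0\}$ for an output $j$. For $S_i\subseteq\mathcal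 K_i$ put $d(S_i)=\sum_{(k,j)\in S_i}d_{ijk}$ and $d^2(S_i)=\sum_{(k,j)\in S_i}d_{ijk}^2$; define $d(S_j)$ and $d^2(S_j)$ analogously for $S_j\subseteq\mathcal K_j$. The LP is: minimize $\sum_{k}w_kC_k$ over variables $C_k,C_{ijk}$ subject to - $C_k\ge C_{ijk}$ and $C_{ijk}\ge r_k+d_{ijk}$ for all $i,j,k$; - $\sum_{(k,j)\in S_i}d_{ijk}C_{ijk}\ge\frac1{2m}\left(d(S_i)^2+d^2(S_i)\right)$ for all $i\in\mathcal I$, $S_i\subseteq\mathcal K_i$; - $\sum_{(k,i)\in S_j}d_{ijk}C_{ijk}\ge\frac1{2m}\left(d(S_j)^2+d^2(S_j)\right)$ for all $j\in\mathcal J$, $S_j\subseteq\mathcal K_j$. Algorithm flow-driven-list-scheduling: compute an optimal LP solution. List all flows as $1,\dots,n$ so that the LP values of their flow variables satisfy $\bar C_1\le\dots\le\bar C_n$ (ties broken arbitrarily). Write $d_f$ for the size of flow $f$. Phase 1 (assignment): initialize all $load_I(i,h)=load_O(j,h)=0$. For $f=1,\dots,n$ in order, if $f$ goes from input $i$ to output $j$, assign $f$ to a core $h^*$ minimizing $load_I(i,h)+load_O(j,h)$ over $h$, then increase $load_I(i,h^*)$ and $load_O(j,h^*)$ by $d_f$. Phase 2 (transmission): on each core $h$ independently, starting when the first coflow is released, and at every time a flow is released or completed, recompute the set of active flows. To do so, scan the released, incomplete flows assigned to $h$ in list order, and make a flow from $i$ to $j$ active if neither input port $i$ nor output port $j$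 of core $h$ is used by a flow already made active in this scan. Active flows are transmitted at rate $1$ until the next release or completion event. -}

module Defs where

open import Level using (_⊔_; suc)
open import Algebra.Bundles using (CommutativeRing)
open import Algebra.Core using (Op₁; Op₂)
open import Algebra.Structures using (IsCommutativeRing)
import Algebra.Properties.Semiring.Mult as SemiringMult
import Algebra.Properties.Semiring.Sum as SemiringSum
open import Data.Bool.Base using (Bool; true; if_then_else_)
open import Data.Fin.Base using (Fin)
import Data.Fin.Properties as Fin
open import Data.List.Base using (List; []; _∷_; filter; foldl; map)
import Data.List.Extrema as Extrema
open import Data.List.Membership.Propositional using (_∈_)
open import Data.List.Relation.Unary.All using (all?)
open import Data.List.Relation.Unary.AllPairs using (AllPairs)
open import Data.List.Relation.Unary.Any using (any?)
open import Data.List.Relation.Unary.Unique.Propositional using (Unique)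
open import Data.Nat.Base as ℕ using (ℕ)
open import Data.Product.Base using (∃; _×_; _,_)
open import Data.Product.Properties using (≡-dec)
open import Data.Sum.Base using (_⊎_)
open import Data.Unit.Base using (⊤)
open import Data.Vec.Functional using (updateAt)
open import Function.Bundles using (_⇔_)
open import Relation.Binary.Bundles using (DecTotalOrder)
open import Relation.Binary.Core using (Rel)
open import Relation.Binary.Definitions using (DecidableEquality)
import Relation.Binary.Properties.DecTotalOrder as DecTotalOrderProperties
open import Relation.Binary.PropositionalEquality.Core using (_≡_; _≢_)
open import Relation.Binary.Structures using (IsDecTotalOrder)
open import Relation.Nullary.Decidable.Core using (Dec; does; ¬?; _×-dec_)
open import Relation.Nullary.Negation.Core using (¬_)

-- The scalars (times, weights, amounts of data), classically ℝ.  The inverse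
-- is total, but its value at 0# is unconstrained.
record OrderedField c ℓ₁ ℓ₂ : Set (suc (c ⊔ ℓ₁ ⊔ ℓ₂)) where
  infix  8 _⁻¹
  infix  8 -_
  infixl 7 _*_
  infixl 6 _+_
  infix  4 _≈_ _≤_
  field
    Carrier           : Set c
    _≈_               : Rel Carrier ℓ₁
    _≤_               : Rel Carrier ℓ₂
    _+_               : Op₂ Carrier
    _*_               : Op₂ Carrier
    -_                : Op₁ Carrier
    _⁻¹               : Op₁ Carrier
    0#                : Carrier
    1#                : Carrier
    isCommutativeRing : IsCommutativeRing _≈_ _+_ _*_ -_ 0# 1#
    isDecTotalOrder   : IsDecTotalOrder _≈_ _≤_
    1≉0               : ¬ 1# ≈ 0#
    *-inverseʳ        : ∀ x → ¬ x ≈ 0# → x * x ⁻¹ ≈ 1#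
    +-monoˡ-≤         : ∀ z {x y} → x ≤ y → x + z ≤ y + z
    *-nonneg          : ∀ {x y} → 0# ≤ x → 0# ≤ y → 0# ≤ x * y

  commutativeRing : CommutativeRing c ℓ₁
  commutativeRing = record { isCommutativeRing = isCommutativeRing }

  decTotalOrder : DecTotalOrder c ℓ₁ ℓ₂
  decTotalOrder = record { isDecTotalOrder = isDecTotalOrder }

  open CommutativeRing commutativeRing public using (_-_; semiring)
  open DecTotalOrder decTotalOrder public using (_≟_; _≤?_; totalOrder)
  open DecTotalOrderProperties decTotalOrder public using (_<_)
  open SemiringSum semiring public using (sum-syntax)
  open SemiringMult semiring using () renaming (_×_ to _×ℕ_)

  _<?_ : ∀ x y → Dec (x < y)
  x <? y = (x ≤? y) ×-dec ¬? (x ≟ y)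

  ι : ℕ → Carrier
  ι n = n ×ℕ 1#

module CoflowScheduling {c ℓ₁ ℓ₂} (F : OrderedField c ℓ₁ ℓ₂) where
  open OrderedField F
  open Extrema totalOrder using (max)

  record Instance (N K : ℕ) : Set (c ⊔ ℓ₁ ⊔ ℓ₂) where
    field
      release   : Fin K → Carrier
      weight    : Fin K → Carrier
      demand    : Fin N → Fin N → Fin K → ℕ
      release≥0 : ∀ k → 0# ≤ release k
      weight>0  : ∀ k → 0# < weight k

  module Problem (m : ℕ) {N K : ℕ} (I : Instance N K) where
    open Instance I

    -- (i , j , k): from input i to output j, belonging to coflow k.
    Triple : Set
    Triple = Fin N × Fin N × Fin K

    src dst : Triple → Fin N
    src (i , _ , _) = i
    dst (_ , j , _) = j

    coflow : Triple → Fin K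
    coflow (_ , _ , k) = k

    _≟ᵗ_ : DecidableEquality Triple
    _≟ᵗ_ = ≡-dec Fin._≟_ (≡-dec Fin._≟_ Fin._≟_)

    demandOf : Triple → ℕ
    demandOf (i , j , k) = demand i j k

    IsFlow : Triple → Set
    IsFlow f = 0 ℕ.< demandOf f

    size : Triple → Carrier
    size f = ι (demandOf f)

    releaseOf : Triple → Carrier
    releaseOf f = release (coflow f)

    weightedSum : (Fin K → Carrier) → Carrier
    weightedSum C = ∑[ k < K ] (weight k * C k)

    -- sent f t is the amount of f transmitted up to time t, i.e. the integral
    -- of its transmission rate.  Rates are non-negative iff sent is
    -- non-decreasing, and the total rate through a port is at most 1 iff over
    -- every [s , t] at most t - s passes through that port.
    record Schedule : Set (c ⊔ ℓ₁ ⊔ ℓ₂) where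
      field
        core : Triple → Fin m
        sent : Triple → Carrier → Carrier

      sentOn : Fin m → Triple → (s t : Carrier) → Carrier
      sentOn h f s t =
        if does (core f Fin.≟ h) then sent f t - sent f s else 0#

      -- The clause release k ≤ t gives a coflow without flows the completion
      -- time release k.
      FinishedBy : Fin K → Carrier → Set (ℓ₁ ⊔ ℓ₂)
      FinishedBy k t =
        release k ≤ t ×
        (∀ f → IsFlow f → coflow f ≡ k → sent f t ≈ size f)

      field
        sent-mono      : ∀ f {s t} → s ≤ t → sent f s ≤ sent f t
        sent-release   : ∀ f {t} → t ≤ releaseOf f → sent f t ≈ 0#
        sent-size      : ∀ f t → sent f t ≤ size f
        inputCapacity  : ∀ h i {s t} → s ≤ t →
          ∑[ j < N ] (∑[ k < K ] sentOn h (i , j , k) s t) ≤ t - s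
        outputCapacity : ∀ h j {s t} → s ≤ t →
          ∑[ i < N ] (∑[ k < K ] sentOn h (i , j , k) s t) ≤ t - s
        completion     : Fin K → Carrier
        finished       : ∀ k → FinishedBy k (completion k)
        earliest       : ∀ k t → FinishedBy k t → completion k ≤ t

      cost : Carrier
      cost = weightedSum completion

    PairSubset : Set
    PairSubset = Fin K → Fin N → Bool

    sumOver : PairSubset → (Fin K → Fin N → Carrier) → Carrier
    sumOver S g = ∑[ k < K ] (∑[ p < N ] (if S k p then g k p else 0#))

    -- The constraints of a single port; d and C are the demands and the
    -- variables of that port, indexed by the coflow and the opposite port.
    PortConstraints : (d : Fin K → Fin N → ℕ) (C : Fin K → Fin N → Carrier) →
                      Set ℓ₂
    PortConstraints d C =
      ∀ (S : PairSubset) → (∀ k p → S k p ≡ true → 0 ℕ.< d k p) →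
      let d⟨S⟩  = sumOver S (λ k p → ι (d k p))
          d²⟨S⟩ = sumOver S (λ k p → ι (d k p) * ι (d k p))
      in  ι (2 ℕ.* m) ⁻¹ * (d⟨S⟩ * d⟨S⟩ + d²⟨S⟩)
            ≤ sumOver S (λ k p → ι (d k p) * C k p)

    record LPFeasible (C : Fin K → Carrier) (Cᶠ : Triple → Carrier) :
                      Set ℓ₂ where
      field
        coflow≥flow  : ∀ f → Cᶠ f ≤ C (coflow f)
        flow≥release : ∀ f → releaseOf f + size f ≤ Cᶠ f
        inputs       : ∀ i → PortConstraints (λ k j → demand i j k)
                                             (λ k j → Cᶠ (i , j , k))
        outputs      : ∀ j → PortConstraints (λ k i → demand i j k)
                                             (λ k i → Cᶠ (i , j , k))

    record LPOptimal (C : Fin K → Carrier) (Cᶠ : Triple → Carrier) :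
                     Set (c ⊔ ℓ₂) where
      field
        feasible : LPFeasible C Cᶠ
        minimal  : ∀ C′ Cᶠ′ → LPFeasible C′ Cᶠ′ →
                   weightedSum C ≤ weightedSum C′

    Load : Set
    Load = Fin N → Fin m → ℕ

    increase : Load → Fin N → Fin m → ℕ → Load
    increase load p h d = updateAt load p (λ row → updateAt row h (ℕ._+ d))

    -- core is a possible outcome of the greedy assignment of the listed flows
    -- from the given loads; ties between cores may be broken in any way.
    GreedyFrom : (loadI loadO : Load) → List Triple → (Triple → Fin m) → Set
    GreedyFrom loadI loadO []       core = ⊤
    GreedyFrom loadI loadO (f ∷ fs) core =
      (∀ h → loadI (src f) (core f) ℕ.+ loadO (dst f) (core f)
               ℕ.≤ loadI (src f) h ℕ.+ loadO (dst f) h) ×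
      GreedyFrom (increase loadI (src f) (core f) (demandOf f))
                 (increase loadO (dst f) (core f) (demandOf f)) fs core

    Greedy : List Triple → (Triple → Fin m) → Set
    Greedy = GreedyFrom (λ _ _ → 0) (λ _ _ → 0)

    module Transmission (order : List Triple) (core : Triple → Fin m)
                        (h : Fin m) where

      Remaining : Set c
      Remaining = Triple → Carrier

      OnCore : Triple → Set
      OnCore f = f ∈ order × core f ≡ h

      Disjoint : Triple → Triple → Set
      Disjoint f g = src f ≢ src g × dst f ≢ dst g

      disjoint? : ∀ f g → Dec (Disjoint f g)
      disjoint? f g = ¬? (src f Fin.≟ src g) ×-dec ¬? (dst f Fin.≟ dst g)

      admit : List Triple → Triple → List Triple
      admit A f = if does (all? (disjoint? f) A) then f ∷ A else A

      candidates : Carrier → Remaining → List Triple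
      candidates t rem = filter
        (λ f → (core f Fin.≟ h) ×-dec (releaseOf f ≤? t) ×-dec (0# <? rem f))
        order

      active : Carrier → Remaining → List Triple
      active t rem = foldl admit [] (candidates t rem)

      advance : (t : Carrier) → Remaining → (t′ : Carrier) → Remaining
      advance t rem t′ f =
        if does (any? (f ≟ᵗ_) (active t rem)) then rem f - (t′ - t) else rem f

      -- The events that can come after time t: a later release, or the
      -- completion of a flow that is active from time t on.
      Event : Carrier → Remaining → Carrier → Set (ℓ₁ ⊔ ℓ₂)
      Event t rem t′ = t < t′ ×
        ((∃ λ f → OnCore f × t′ ≈ releaseOf f) ⊎
         (∃ λ f → f ∈ active t rem × t′ ≈ t + rem f))

      NextEvent : Carrier → Remaining → Carrier → Set (c ⊔ ℓ₁ ⊔ ℓ₂)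
      NextEvent t rem t′ =
        Event t rem t′ × (∀ s → Event t rem s → t′ ≤ s)

      data Run (t : Carrier) (rem : Remaining) : Set (c ⊔ ℓ₁ ⊔ ℓ₂) where
        done : (∀ f → OnCore f → rem f ≈ 0#) → Run t rem
        next : ∀ t′ → NextEvent t rem t′ → Run t′ (advance t rem t′) →
               Run t rem

      finishTime : ∀ {t rem} → Run t rem → Triple → Carrier
      finishTime {t}       (done _)     f = t
      finishTime {t} {rem} (next _ _ r) f =
        if does (rem f ≟ 0#) then t else finishTime r f

    record Execution : Set (c ⊔ ℓ₁ ⊔ ℓ₂) where
      field
        lpC        : Fin K → Carrier
        lpCᶠ       : Triple → Carrier
        lpOptimal  : LPOptimal lpC lpCᶠ
        order      : List Triple
        unique     : Unique order
        complete   : ∀ f → f ∈ order ⇔ IsFlow f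
        sorted     : AllPairs (λ f g → lpCᶠ f ≤ lpCᶠ g) order
        core       : Triple → Fin m
        greedy     : Greedy order core
        -- Starting at 0# or at the first release is the same: nothing is
        -- active in between.
        run        : ∀ h → Transmission.Run order core h 0# size

      flowCompletion : Triple → Carrier
      flowCompletion f =
        Transmission.finishTime order core (core f) (run (core f)) f

      -- Flows finish after their release, so the lower bound release k only
      -- matters for a coflow without flows.
      completion : Fin K → Carrier
      completion k = max (release k)
        (map flowCompletion (filter (λ f → coflow f Fin.≟ k) order))

      cost : Carrier
      cost = weightedSum completion

{-# OPTIONS --safe #-}

-- The LP optimum is at most OPT: giving every flow variable the completion time
-- of its coflow in the schedule σ is feasible.  For the load constraints, the
-- flows on one port of one core that finish by time t have total size at most
-- t; this is summed over the flows of S on that core and, by Cauchy–Schwarz,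
-- over the cores.
--
-- Conversely, on its core a flow f waits after its release only while earlier
-- flows that share one of its ports are transmitted, so it finishes by
-- r_f + d_f + load_I + load_O, with the loads just before f is assigned.  By the
-- greedy choice, load_I + load_O is at most 1/m times the total size of the
-- earlier flows on the two ports, and the LP constraint for the earlier flows on
-- a port bounds their total size by 2m C̄_f.  With r_f + d_f ≤ C̄_f this gives
-- 5 C̄_f, and 5 ≤ 6 - 2/m because m ≥ 2.

module Submission where

open import Defs
open import Algebra.Bundles using (CommutativeRing)
import Algebra.Properties.Ring as RingProperties
import Algebra.Properties.Semiring.Mult as SemiringMult
import Algebra.Properties.Semiring.Sum as SemiringSum
import Algebra.Solver.Ring.NaturalCoefficients.Default as NatCoeffSolver
open import Data.Bool.Base using (Bool; true; false; if_then_else_)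
open import Data.Empty using (⊥-elim)
open import Data.Fin.Base using (Fin; zero; suc)
import Data.Fin.Properties as Fin
open import Data.List.Base using (List; []; _∷_; _++_; filter; foldl)
import Data.List.Extrema as Extrema
import Data.List.Properties as List
open import Data.List.Membership.Propositional using (_∈_; find)
open import Data.List.Membership.Propositional.Properties using (∈-++⁺ˡ; ∈-++⁺ʳ; ∈-filter⁻; ∈-∃++)
open import Data.List.Relation.Unary.All as All using (All; all?)
import Data.List.Relation.Unary.All.Properties as All
open import Data.List.Relation.Unary.AllPairs using (AllPairs; []; _∷_)
open import Data.List.Relation.Unary.Any using (here; there; any?)
open import Data.List.Relation.Unary.Unique.Propositional using (Unique)
open import Data.Nat.Base as ℕ using (ℕ; zero; suc)
import Data.Nat.Properties as ℕ
open import Data.Product.Base using (_×_; _,_; proj₁; proj₂; ∃; ∃₂)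
open import Data.Sum.Base using (_⊎_; inj₁; inj₂)
open import Data.Vec.Functional using (updateAt)
open import Data.Vec.Functional.Properties using (updateAt-updates; updateAt-minimal)
open import Function.Base using (_∘_)
open import Function.Bundles using (Equivalence)
open import Relation.Binary.Core using (Rel)
open import Relation.Binary.Bundles using (DecTotalOrder)
import Relation.Binary.PropositionalEquality as ≡
open ≡ using (_≡_)
import Relation.Binary.Reasoning.PartialOrder as PartialOrderReasoning
open import Relation.Nullary.Decidable.Core using (Dec; yes; no; does; _×-dec_)
open import Relation.Nullary.Negation.Core using (¬_)

-- Prefixes of pairwise related lists.

module _ {a r} {A : Set a} {R : Rel A r} where

  AllPairs-++⁻ˡ : ∀ xs {ys} → AllPairs R (xs ++ ys) → AllPairs R xs
  AllPairs-++⁻ˡ []       _         = []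
  AllPairs-++⁻ˡ (x ∷ xs) (rx ∷ rs) = All.++⁻ˡ xs rx ∷ AllPairs-++⁻ˡ xs rs

  AllPairs-++⁻ : ∀ {x y} xs {ys} → AllPairs R (xs ++ ys) → x ∈ xs → y ∈ ys → R x y
  AllPairs-++⁻ (x ∷ xs) (rx ∷ _) (here ≡.refl) y∈ys = All.lookup rx (∈-++⁺ʳ xs y∈ys)
  AllPairs-++⁻ (x ∷ xs) (_ ∷ rs) (there x∈xs)  y∈ys = AllPairs-++⁻ xs rs x∈xs y∈ys

does-true : ∀ {p} {P : Set p} (P? : Dec P) → does P? ≡ true → P
does-true (yes p) _ = p

-- Arithmetic in ordered fields.

module OrderedFieldProperties {c ℓ₁ ℓ₂} (F : OrderedField c ℓ₁ ℓ₂) where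
  open OrderedField F
  open CommutativeRing commutativeRing using
    ( refl; sym; trans; ring; commutativeSemiring
    ; +-cong; +-congˡ; +-congʳ; +-assoc; +-comm; +-identityˡ; +-identityʳ
    ; -‿inverseˡ; -‿inverseʳ
    ; *-cong; *-congˡ; *-congʳ; *-assoc; *-comm; *-identityˡ; *-identityʳ
    ; distribˡ; distribʳ; zeroˡ; zeroʳ )
    public
  open DecTotalOrder decTotalOrder using (poset; total; ≤-respˡ-≈; ≤-respʳ-≈)
    renaming (refl to ≤-refl; reflexive to ≤-reflexive; trans to ≤-trans; antisym to ≤-antisym)
    public
  open SemiringMult semiring using (×-homo-+)
  open SemiringSum semiring using
    (sum; sum-cong-≋; ∑-distrib-+; ∑-comm; *-distribˡ-sum; *-distribʳ-sum; sum-replicate-zero)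
    public
  open NatCoeffSolver commutativeSemiring public
    using (solve; _:+_; _:*_; _:=_; con)
  open PartialOrderReasoning poset public
  open Extrema totalOrder using (max≤v⁺) public

  private variable
    x y z u v : Carrier
    n : ℕ

  +-monoʳ-≤ : ∀ z → x ≤ y → z + x ≤ z + y
  +-monoʳ-≤ z x≤y = ≤-respˡ-≈ (+-comm _ z) (≤-respʳ-≈ (+-comm _ z) (+-monoˡ-≤ z x≤y))

  +-mono-≤ : x ≤ y → u ≤ v → x + u ≤ y + v
  +-mono-≤ {y = y} {u} x≤y u≤v = ≤-trans (+-monoˡ-≤ u x≤y) (+-monoʳ-≤ y u≤v)

  x+y-y≈x : ∀ x y → x + y - y ≈ x
  x+y-y≈x x y = trans (+-assoc x y (- y)) (trans (+-congˡ (-‿inverseʳ y)) (+-identityʳ x))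

  x-y+y≈x : ∀ x y → x - y + y ≈ x
  x-y+y≈x x y = trans (+-assoc x (- y) y) (trans (+-congˡ (-‿inverseˡ y)) (+-identityʳ x))

  y+[x-y]≈x : ∀ x y → y + (x - y) ≈ x
  y+[x-y]≈x x y = trans (+-comm y _) (x-y+y≈x x y)

  x+z≤y⇒x≤y-z : x + z ≤ y → x ≤ y - z
  x+z≤y⇒x≤y-z {x} {z} p = ≤-respˡ-≈ (x+y-y≈x x z) (+-monoˡ-≤ (- z) p)

  x≤y-z⇒x+z≤y : x ≤ y - z → x + z ≤ y
  x≤y-z⇒x+z≤y {y = y} {z} p = ≤-respʳ-≈ (x-y+y≈x y z) (+-monoˡ-≤ z p)

  x≤y⇒0≤y-x : x ≤ y → 0# ≤ y - x
  x≤y⇒0≤y-x {x} p = x+z≤y⇒x≤y-z (≤-respˡ-≈ (sym (+-identityˡ x)) p)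

  x≤x+y : 0# ≤ y → x ≤ x + y
  x≤x+y {x = x} p = ≤-respˡ-≈ (+-identityʳ x) (+-monoʳ-≤ x p)

  y≤x+y : 0# ≤ x → y ≤ x + y
  y≤x+y {y = y} p = ≤-respˡ-≈ (+-identityˡ y) (+-monoˡ-≤ y p)

  x-y≤x : 0# ≤ y → x - y ≤ x
  x-y≤x {y} {x} p = ≤-respʳ-≈ (x-y+y≈x x y) (x≤x+y p)

  +-nonneg : 0# ≤ x → 0# ≤ y → 0# ≤ x + y
  +-nonneg p q = ≤-trans p (x≤x+y q)

  +-cancelʳ-≤ : ∀ z → x + z ≤ y + z → x ≤ y
  +-cancelʳ-≤ {y = y} z p = ≤-respʳ-≈ (x+y-y≈x y z) (x+z≤y⇒x≤y-z p)

  *-monoˡ-≤ : 0# ≤ z → x ≤ y → z * x ≤ z * y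
  *-monoˡ-≤ {z} {x} {y} 0≤z x≤y = begin
    z * x                ≤⟨ y≤x+y (*-nonneg 0≤z (x≤y⇒0≤y-x x≤y)) ⟩
    z * (y - x) + z * x  ≈⟨ distribˡ z (y - x) x ⟨
    z * (y - x + x)      ≈⟨ *-congˡ (x-y+y≈x y x) ⟩
    z * y                ∎

  *-monoʳ-≤ : 0# ≤ z → x ≤ y → x * z ≤ y * z
  *-monoʳ-≤ {z} p q = ≤-respˡ-≈ (*-comm z _) (≤-respʳ-≈ (*-comm z _) (*-monoˡ-≤ p q))

  -- The axioms leave the sign of `1#` open. If `1# ≤ 0#`, then `- 1#` is non-negative, and so is
  -- its square, which is `1#`.
  0≤1 : 0# ≤ 1#
  0≤1 with total 0# 1#
  ... | inj₁ 0≤1 = 0≤1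
  ... | inj₂ 1≤0 = ≤-respʳ-≈ [-1][-1]≈1 (*-nonneg 0≤-1 0≤-1)
    where
    open RingProperties ring using (-1*x≈-x; -‿involutive)
    0≤-1 : 0# ≤ - 1#
    0≤-1 = ≤-respʳ-≈ (+-identityˡ (- 1#)) (x≤y⇒0≤y-x 1≤0)
    [-1][-1]≈1 : - 1# * - 1# ≈ 1#
    [-1][-1]≈1 = trans (-1*x≈-x (- 1#)) (-‿involutive 1#)

  ≤∧≉⇒≰ : x < y → ¬ y ≤ x
  ≤∧≉⇒≰ (x≤y , x≉y) y≤x = x≉y (≤-antisym x≤y y≤x)

  ≰⇒< : ¬ x ≤ y → y < x
  ≰⇒< {x} {y} x≰y with total x y
  ... | inj₁ x≤y = ⊥-elim (x≰y x≤y)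
  ... | inj₂ y≤x = y≤x , λ y≈x → x≰y (≤-reflexive (sym y≈x))

  ⁻¹-nonneg : 0# < x → 0# ≤ x ⁻¹
  ⁻¹-nonneg {x} (0≤x , 0≉x) with total 0# (x ⁻¹)
  ... | inj₁ p = p
  ... | inj₂ p = ⊥-elim (1≉0 (≤-antisym 1≤0 0≤1))
    where
    1≤0 : 1# ≤ 0#
    1≤0 = begin
      1#        ≈⟨ *-inverseʳ x (0≉x ∘ sym) ⟨
      x * x ⁻¹  ≤⟨ *-monoˡ-≤ 0≤x p ⟩
      x * 0#    ≈⟨ zeroʳ x ⟩
      0#        ∎

  *-cancelˡ-≤ : 0# < z → z * x ≤ z * y → x ≤ y
  *-cancelˡ-≤ {z} {x} {y} 0<z p = begin
    x               ≈⟨ lemma x ⟨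
    z ⁻¹ * (z * x)  ≤⟨ *-monoˡ-≤ (⁻¹-nonneg 0<z) p ⟩
    z ⁻¹ * (z * y)  ≈⟨ lemma y ⟩
    y               ∎
    where
    lemma : ∀ x → z ⁻¹ * (z * x) ≈ x
    lemma x = trans (sym (*-assoc _ z x))
      (trans (*-congʳ (trans (*-comm _ z) (*-inverseʳ z (proj₂ 0<z ∘ sym)))) (*-identityˡ x))

  x≤y*z⇒y⁻¹*x≤z : 0# < y → x ≤ y * z → y ⁻¹ * x ≤ z
  x≤y*z⇒y⁻¹*x≤z {y} {x} {z} 0<y p = *-cancelˡ-≤ 0<y (≤-respˡ-≈ (sym (trans (sym (*-assoc y _ x))
    (trans (*-congʳ (*-inverseʳ y (proj₂ 0<y ∘ sym))) (*-identityˡ x)))) p)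

  y⁻¹*x≤z⇒x≤y*z : 0# < y → y ⁻¹ * x ≤ z → x ≤ y * z
  y⁻¹*x≤z⇒x≤y*z {y} {x} {z} 0<y p = ≤-respˡ-≈ (trans (sym (*-assoc y _ x))
    (trans (*-congʳ (*-inverseʳ y (proj₂ 0<y ∘ sym))) (*-identityˡ x))) (*-monoˡ-≤ (proj₁ 0<y) p)

  -- By symmetry let `x ≤ y` and write `y` as `x + d`; the two sides then differ by `d * d`. The
  -- substitution removes subtraction, so a semiring identity remains.
  xy+xy≤x²+y² : ∀ x y → x * y + x * y ≤ x * x + y * y
  xy+xy≤x²+y² x y = wlog (total x y)
    where
    ordered : ∀ {x y} → x ≤ y → x * y + x * y ≤ x * x + y * y
    ordered {x} {y} x≤y = begin
      x * y + x * y                      ≈⟨ +-cong (*-congˡ y≈x+d) (*-congˡ y≈x+d) ⟩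
      x * (x + d) + x * (x + d)          ≤⟨ x≤x+y (*-nonneg 0≤d 0≤d) ⟩
      x * (x + d) + x * (x + d) + d * d  ≈⟨ solve 2 (λ x d → x :* (x :+ d) :+ x :* (x :+ d) :+ d :* d
                                                    := x :* x :+ (x :+ d) :* (x :+ d)) refl x d ⟩
      x * x + (x + d) * (x + d)          ≈⟨ +-congˡ (*-cong y≈x+d y≈x+d) ⟨
      x * x + y * y                      ∎
      where
      d = y - x
      0≤d = x≤y⇒0≤y-x x≤y
      y≈x+d = sym (y+[x-y]≈x y x)
    wlog : x ≤ y ⊎ y ≤ x → x * y + x * y ≤ x * x + y * y
    wlog (inj₁ x≤y) = ordered x≤y
    wlog (inj₂ y≤x) = begin
      x * y + x * y  ≈⟨ +-cong (*-comm x y) (*-comm x y) ⟩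
      y * x + y * x  ≤⟨ ordered y≤x ⟩
      y * y + x * x  ≈⟨ +-comm _ _ ⟩
      x * x + y * y  ∎

  ι-+ : ∀ a b → ι (a ℕ.+ b) ≈ ι a + ι b
  ι-+ a b = ×-homo-+ 1# a b

  0≤ι : ∀ n → 0# ≤ ι n
  0≤ι zero    = ≤-refl
  0≤ι (suc n) = +-nonneg 0≤1 (0≤ι n)

  ι-mono-≤ : ∀ {a b} → a ℕ.≤ b → ι a ≤ ι b
  ι-mono-≤ {b = b} ℕ.z≤n = 0≤ι b
  ι-mono-≤ (ℕ.s≤s p)     = +-monoʳ-≤ 1# (ι-mono-≤ p)

  0<ι : ∀ {n} → 0 ℕ.< n → 0# < ι n
  0<ι {n} 0<n = 0≤ι n , λ 0≈ιn → 1≉0 (≤-antisym (begin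
    1#  ≈⟨ +-identityʳ 1# ⟨
    ι 1 ≤⟨ ι-mono-≤ 0<n ⟩
    ι n ≈⟨ 0≈ιn ⟨
    0#  ∎) 0≤1)

  ι[2m]*y≈ : ∀ m y → ι m * (y + y) ≈ ι (2 ℕ.* m) * y
  ι[2m]*y≈ m y = begin-equality
    -- `2 ℕ.* m` unfolds to `m ℕ.+ (m ℕ.+ 0)`, hence the summand `con 0`.
    ι m * (y + y)             ≈⟨ solve 2 (λ a y → a :* (y :+ y) := (a :+ (a :+ con 0)) :* y) refl (ι m) y ⟩
    (ι m + (ι m + 0#)) * y    ≈⟨ *-congʳ (+-congˡ (ι-+ m 0)) ⟨
    (ι m + ι (m ℕ.+ 0)) * y   ≈⟨ *-congʳ (ι-+ m (m ℕ.+ 0)) ⟨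
    ι (2 ℕ.* m) * y           ∎

  -- A term of a sum restricted to an index set. `sumOver` and `sentOn` unfold to the same
  -- conditional, so the lemmas below apply to them directly.
  only : Bool → Carrier → Carrier
  only b x = if b then x else 0#

  only-nonneg : ∀ b → 0# ≤ x → 0# ≤ only b x
  only-nonneg true  0≤x = 0≤x
  only-nonneg false 0≤x = ≤-refl

  only-mono : ∀ b → x ≤ y → only b x ≤ only b y
  only-mono true  x≤y = x≤y
  only-mono false x≤y = ≤-refl

  only-≤ : ∀ b → 0# ≤ x → only b x ≤ x
  only-≤ true  0≤x = ≤-refl
  only-≤ false 0≤x = 0≤x

  only-zero : ∀ b → only b 0# ≈ 0#
  only-zero true  = refl
  only-zero false = refl

  only-* : ∀ b → only b (x * y) ≈ only b x * y
  only-* true          = refl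
  only-* {y = y} false = sym (zeroˡ y)

  only-square : ∀ b → only b (x * x) ≈ only b x * only b x
  only-square true  = refl
  only-square false = sym (zeroˡ 0#)

  only-yes : ∀ {p} {P : Set p} (P? : Dec P) → P → only (does P?) x ≡ x
  only-yes (yes _) p = ≡.refl
  only-yes (no ¬p) p = ⊥-elim (¬p p)

  only-⇒ : ∀ {p q} {P : Set p} {Q : Set q} (P? : Dec P) (Q? : Dec Q) →
           (P → Q) → 0# ≤ x → only (does P?) x ≤ only (does Q?) x
  only-⇒ (no _)  Q?      P⇒Q 0≤x = only-nonneg (does Q?) 0≤x
  only-⇒ (yes p) (yes _) P⇒Q 0≤x = ≤-refl
  only-⇒ (yes p) (no ¬q) P⇒Q 0≤x = ⊥-elim (¬q (P⇒Q p))

  -- `A` and `B` together exclude `P`, so at most one term on the left is present, and either one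
  -- forces `Q`. The conjunction is a nested `only` to match the shape of `∑∑-delta`.
  only-⊎ : ∀ {a b p q} {A : Set a} {B : Set b} {P : Set p} {Q : Set q}
           (A? : Dec A) (B? : Dec B) (P? : Dec P) (Q? : Dec Q) →
           (A → B → ¬ P) → (A → B → Q) → (P → Q) → 0# ≤ x →
           only (does A?) (only (does B?) x) + only (does P?) x ≤ only (does Q?) x
  only-⊎ (no _) B? P? Q? _ _ P⇒Q 0≤x =
    ≤-respˡ-≈ (sym (+-identityˡ _)) (only-⇒ P? Q? P⇒Q 0≤x)
  only-⊎ (yes _) (no _) P? Q? _ _ P⇒Q 0≤x =
    ≤-respˡ-≈ (sym (+-identityˡ _)) (only-⇒ P? Q? P⇒Q 0≤x)
  only-⊎ (yes a) (yes b) (yes p) _       AB⇒¬P _    _ _ = ⊥-elim (AB⇒¬P a b p)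
  only-⊎ (yes a) (yes b) (no _)  (no ¬q) _     AB⇒Q _ _ = ⊥-elim (¬q (AB⇒Q a b))
  only-⊎ (yes a) (yes b) (no _)  (yes _) _     _    _ _ = ≤-reflexive (+-identityʳ _)

  -- Finite sums and Cauchy-Schwarz.

  sum-mono : ∀ {f g : Fin n → Carrier} → (∀ i → f i ≤ g i) → sum f ≤ sum g
  sum-mono {zero}  f≤g = ≤-refl
  sum-mono {suc n} f≤g = +-mono-≤ (f≤g zero) (sum-mono (f≤g ∘ suc))

  ∑-const : ∀ n x → ∑[ i < n ] x ≈ ι n * x
  ∑-const zero    x = sym (zeroˡ x)
  ∑-const (suc n) x = trans (+-cong (sym (*-identityˡ x)) (∑-const n x)) (sym (distribʳ x 1# (ι n)))

  sum-nonneg : ∀ {f : Fin n → Carrier} → (∀ i → 0# ≤ f i) → 0# ≤ sum f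
  sum-nonneg {n} 0≤f = ≤-respˡ-≈ (sum-replicate-zero n) (sum-mono 0≤f)

  ∑-delta : ∀ i (f : Fin n → Carrier) → ∑[ j < n ] (only (does (i Fin.≟ j)) (f j)) ≈ f i
  ∑-delta {suc n} zero    f = trans (+-congˡ (sum-replicate-zero n)) (+-identityʳ (f zero))
  ∑-delta {suc n} (suc i) f = trans (+-identityˡ _) (∑-delta i (f ∘ suc))

  -- Cauchy-Schwarz against the constant vector, by induction. The cross terms are bounded summand
  -- by summand through `xy+xy≤x²+y²`; this gives `n` more copies of `a * a` and one more `Q`, just
  -- what the step from `n` to `suc n` allows.
  [∑]²≤n*∑² : ∀ (f : Fin n → Carrier) → sum f * sum f ≤ ι n * ∑[ i < n ] (f i * f i)
  [∑]²≤n*∑² {zero}  f = ≤-refl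
  [∑]²≤n*∑² {suc n} f = begin
    (a + A) * (a + A)
      ≈⟨ solve 2 (λ a A → (a :+ A) :* (a :+ A) := a :* a :+ (a :* A :+ a :* A) :+ A :* A) refl a A ⟩
    a * a + (a * A + a * A) + A * A
      ≤⟨ +-mono-≤ (+-monoʳ-≤ (a * a) cross) ([∑]²≤n*∑² (f ∘ suc)) ⟩
    a * a + (ι n * (a * a) + Q) + ι n * Q
      ≈⟨ solve 3 (λ a m Q → a :* a :+ (m :* (a :* a) :+ Q) :+ m :* Q
                          := (con 1 :+ m) :* (a :* a :+ Q)) refl a (ι n) Q ⟩
    (1# + ι n) * (a * a + Q) ∎
    where
    a = f zero
    A = sum (f ∘ suc)
    Q = ∑[ i < n ] (f (suc i) * f (suc i))
    cross : a * A + a * A ≤ ι n * (a * a) + Q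
    cross = begin
      a * A + a * A
        ≈⟨ +-cong (*-distribˡ-sum a (f ∘ suc)) (*-distribˡ-sum a (f ∘ suc)) ⟩
      ∑[ i < n ] (a * f (suc i)) + ∑[ i < n ] (a * f (suc i))
        ≈⟨ ∑-distrib-+ {n} _ _ ⟨
      ∑[ i < n ] (a * f (suc i) + a * f (suc i))
        ≤⟨ sum-mono (λ i → xy+xy≤x²+y² a (f (suc i))) ⟩
      ∑[ i < n ] (a * a + f (suc i) * f (suc i))
        ≈⟨ ∑-distrib-+ {n} (λ _ → a * a) _ ⟩
      ∑[ i < n ] (a * a) + Q
        ≈⟨ +-congʳ (∑-const n (a * a)) ⟩
      ι n * (a * a) + Q ∎

  module _ {a} {A : Set a} where

    lsum : List A → (A → Carrier) → Carrier
    lsum []       f = 0#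
    lsum (x ∷ xs) f = f x + lsum xs f

    lsum-mono : ∀ {f g : A → Carrier} xs → (∀ x → f x ≤ g x) → lsum xs f ≤ lsum xs g
    lsum-mono []       f≤g = ≤-refl
    lsum-mono (x ∷ xs) f≤g = +-mono-≤ (f≤g x) (lsum-mono xs f≤g)

    lsum-nonneg : ∀ {f : A → Carrier} xs → (∀ x → 0# ≤ f x) → 0# ≤ lsum xs f
    lsum-nonneg []       0≤f = ≤-refl
    lsum-nonneg (x ∷ xs) 0≤f = +-nonneg (0≤f x) (lsum-nonneg xs 0≤f)

    -- A single element pays for the whole decrease `z`. It serves to show that one transmitted flow
    -- reduces the load of a port.
    lsum-drop : ∀ {f g : A → Carrier} {x xs} → x ∈ xs → f x + z ≤ g x → (∀ y → f y ≤ g y) →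
                lsum xs f + z ≤ lsum xs g
    lsum-drop {z} {f} {xs = _ ∷ xs} (here ≡.refl) fx+z≤gx f≤g = ≤-respˡ-≈
      (solve 3 (λ a b z → a :+ z :+ b := a :+ b :+ z) refl (f _) (lsum xs f) z)
      (+-mono-≤ fx+z≤gx (lsum-mono xs f≤g))
    lsum-drop {xs = y ∷ _} (there x∈xs) fx+z≤gx f≤g = ≤-respˡ-≈
      (sym (+-assoc _ _ _)) (+-mono-≤ (f≤g y) (lsum-drop x∈xs fx+z≤gx f≤g))

  -- Double sums and the load inequality on parallel cores.

  module _ {K N : ℕ} where

    Matrix : Set c
    Matrix = Fin K → Fin N → Carrier

    ∑∑ : Matrix → Carrier
    ∑∑ f = ∑[ k < K ] (∑[ p < N ] f k p)

    ∑∑-cong : ∀ {f g : Matrix} → (∀ k p → f k p ≈ g k p) → ∑∑ f ≈ ∑∑ g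
    ∑∑-cong f≈g = sum-cong-≋ (λ k → sum-cong-≋ (f≈g k))

    ∑∑-mono : ∀ {f g : Matrix} → (∀ k p → f k p ≤ g k p) → ∑∑ f ≤ ∑∑ g
    ∑∑-mono f≤g = sum-mono (λ k → sum-mono (f≤g k))

    ∑∑-nonneg : ∀ {f : Matrix} → (∀ k p → 0# ≤ f k p) → 0# ≤ ∑∑ f
    ∑∑-nonneg 0≤f = sum-nonneg (λ k → sum-nonneg (0≤f k))

    ∑∑-distrib-+ : ∀ (f g : Matrix) → ∑∑ (λ k p → f k p + g k p) ≈ ∑∑ f + ∑∑ g
    ∑∑-distrib-+ f g = trans (sum-cong-≋ (λ k → ∑-distrib-+ (f k) (g k))) (∑-distrib-+ {K} _ _)

    *-distribˡ-∑∑ : ∀ x (f : Matrix) → x * ∑∑ f ≈ ∑∑ (λ k p → x * f k p)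
    *-distribˡ-∑∑ x f = trans (*-distribˡ-sum {K} x _) (sum-cong-≋ (λ k → *-distribˡ-sum x (f k)))

    *-distribʳ-∑∑ : ∀ x (f : Matrix) → ∑∑ f * x ≈ ∑∑ (λ k p → f k p * x)
    *-distribʳ-∑∑ x f = trans (*-distribʳ-sum {K} x _) (sum-cong-≋ (λ k → *-distribʳ-sum x (f k)))

    ∑∑-∑-comm : ∀ (f : Fin K → Fin N → Fin n → Carrier) →
                ∑∑ (λ k p → ∑[ h < n ] f k p h) ≈ ∑[ h < n ] ∑∑ (λ k p → f k p h)
    ∑∑-∑-comm {n} f = trans (sum-cong-≋ (λ k → ∑-comm (f k))) (∑-comm {K} {n} _)

    ∑∑-comm : ∀ (f : Fin K → Fin N → Fin K → Fin N → Carrier) →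
              ∑∑ (λ k p → ∑∑ (f k p)) ≈ ∑∑ (λ k′ p′ → ∑∑ (λ k p → f k p k′ p′))
    ∑∑-comm f = trans (∑∑-∑-comm {K} _) (sum-cong-≋ (λ k′ → ∑∑-∑-comm (λ k p → f k p k′)))

    ∑∑-delta : ∀ k p (f : Matrix) →
               ∑∑ (λ k′ p′ → only (does (k Fin.≟ k′)) (only (does (p Fin.≟ p′)) (f k′ p′))) ≈ f k p
    ∑∑-delta k p f = trans (sum-cong-≋ inner) (trans (∑-delta k _) (∑-delta p (f k)))
      where
      inner : ∀ k′ → ∑[ p′ < N ] (only (does (k Fin.≟ k′)) (only (does (p Fin.≟ p′)) (f k′ p′))) ≈
                     only (does (k Fin.≟ k′)) (∑[ p′ < N ] (only (does (p Fin.≟ p′)) (f k′ p′)))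
      inner k′ with does (k Fin.≟ k′)
      ... | true  = refl
      ... | false = sum-replicate-zero N

    -- Summing the hypothesis against a and adding the same sum with the two
    -- indices exchanged counts every pair at least once, and the diagonal twice.
    parallelInequality :
      ∀ (a C : Matrix) → (∀ k p → 0# ≤ a k p) →
      (∀ k p → ∑∑ (λ k′ p′ → only (does (C k′ p′ ≤? C k p)) (a k′ p′)) ≤ C k p) →
      let Y = ∑∑ (λ k p → a k p * C k p) in
      ∑∑ a * ∑∑ a + ∑∑ (λ k p → a k p * a k p) ≤ Y + Y
    parallelInequality a C 0≤a volume = begin
      ∑∑ a * ∑∑ a + ∑∑ (λ k p → a k p * a k p)
        ≈⟨ +-congʳ (*-distribʳ-∑∑ (∑∑ a) a) ⟩
      ∑∑ (λ k p → a k p * ∑∑ a) + ∑∑ (λ k p → a k p * a k p)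
        ≈⟨ ∑∑-distrib-+ _ _ ⟨
      ∑∑ (λ k p → a k p * ∑∑ a + a k p * a k p)
        ≤⟨ ∑∑-mono rows ⟩
      ∑∑ (λ k p → a k p * ∑∑ (before k p) + a k p * ∑∑ (after k p))
        ≈⟨ ∑∑-distrib-+ _ _ ⟩
      ∑∑ (λ k p → a k p * ∑∑ (before k p)) + ∑∑ (λ k p → a k p * ∑∑ (after k p))
        ≈⟨ +-congˡ transpose ⟩
      ∑∑ (λ k p → a k p * ∑∑ (before k p)) + ∑∑ (λ k p → a k p * ∑∑ (before k p))
        ≤⟨ +-mono-≤ bound bound ⟩
      ∑∑ (λ k p → a k p * C k p) + ∑∑ (λ k p → a k p * C k p) ∎
      where
      before after diagonal : Fin K → Fin N → Matrix
      before k p k′ p′ = only (does (C k′ p′ ≤? C k p)) (a k′ p′)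
      after k p k′ p′ = only (does (C k p ≤? C k′ p′)) (a k′ p′)
      diagonal k p k′ p′ = only (does (k Fin.≟ k′)) (only (does (p Fin.≟ p′)) (a k′ p′))

      bound : ∑∑ (λ k p → a k p * ∑∑ (before k p)) ≤ ∑∑ (λ k p → a k p * C k p)
      bound = ∑∑-mono (λ k p → *-monoˡ-≤ (0≤a k p) (volume k p))

      exchange : ∀ b x y → x * only b y ≈ y * only b x
      exchange true  x y = *-comm x y
      exchange false x y = trans (zeroʳ x) (sym (zeroʳ y))

      transpose : ∑∑ (λ k p → a k p * ∑∑ (after k p)) ≈ ∑∑ (λ k p → a k p * ∑∑ (before k p))
      transpose = begin-equality
        ∑∑ (λ k p → a k p * ∑∑ (after k p))
          ≈⟨ ∑∑-cong (λ k p → *-distribˡ-∑∑ (a k p) (after k p)) ⟩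
        ∑∑ (λ k p → ∑∑ (λ k′ p′ → a k p * after k p k′ p′))
          ≈⟨ ∑∑-comm (λ k p k′ p′ → a k p * after k p k′ p′) ⟩
        ∑∑ (λ k′ p′ → ∑∑ (λ k p → a k p * after k p k′ p′))
          ≈⟨ ∑∑-cong (λ k′ p′ → ∑∑-cong (λ k p →
               exchange (does (C k p ≤? C k′ p′)) (a k p) (a k′ p′))) ⟩
        ∑∑ (λ k′ p′ → ∑∑ (λ k p → a k′ p′ * before k′ p′ k p))
          ≈⟨ ∑∑-cong (λ k p → *-distribˡ-∑∑ (a k p) (before k p)) ⟨
        ∑∑ (λ k p → a k p * ∑∑ (before k p)) ∎

      pair : ∀ k p k′ p′ → a k′ p′ + diagonal k p k′ p′ ≤ before k p k′ p′ + after k p k′ p′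
      -- Off the diagonal, totality of the order makes at least one comparison true. On it both are
      -- true by reflexivity, which pays for the extra `diagonal` term.
      pair k p k′ p′ with k Fin.≟ k′ | p Fin.≟ p′ | C k′ p′ ≤? C k p | C k p ≤? C k′ p′
      ... | no _  | _     | yes _ | v     = +-monoʳ-≤ _ (only-nonneg (does v) (0≤a k′ p′))
      ... | no _  | _     | no _  | yes _ = ≤-reflexive (+-comm _ _)
      ... | yes _ | no _  | yes _ | v     = +-monoʳ-≤ _ (only-nonneg (does v) (0≤a k′ p′))
      ... | yes _ | no _  | no _  | yes _ = ≤-reflexive (+-comm _ _)
      ... | yes _ | yes _ | yes _ | yes _ = ≤-refl
      ... | yes ≡.refl | yes ≡.refl | no ≰ | _ = ⊥-elim (≰ ≤-refl)
      ... | yes ≡.refl | yes ≡.refl | _ | no ≰ = ⊥-elim (≰ ≤-refl)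
      ... | _ | _ | no u | no v = ⊥-elim (u (proj₁ (≰⇒< v)))

      rows : ∀ k p → a k p * ∑∑ a + a k p * a k p ≤
                     a k p * ∑∑ (before k p) + a k p * ∑∑ (after k p)
      rows k p = begin
        a k p * ∑∑ a + a k p * a k p
          ≈⟨ distribˡ _ _ _ ⟨
        a k p * (∑∑ a + a k p)
          ≈⟨ *-congˡ (+-congˡ (∑∑-delta k p a)) ⟨
        a k p * (∑∑ a + ∑∑ (diagonal k p))
          ≈⟨ *-congˡ (∑∑-distrib-+ a (diagonal k p)) ⟨
        a k p * ∑∑ (λ k′ p′ → a k′ p′ + diagonal k p k′ p′)
          ≤⟨ *-monoˡ-≤ (0≤a k p) (∑∑-mono (pair k p)) ⟩
        a k p * ∑∑ (λ k′ p′ → before k p k′ p′ + after k p k′ p′)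
          ≈⟨ *-congˡ (∑∑-distrib-+ (before k p) (after k p)) ⟩
        a k p * (∑∑ (before k p) + ∑∑ (after k p))
          ≈⟨ distribˡ _ _ _ ⟩
        a k p * ∑∑ (before k p) + a k p * ∑∑ (after k p) ∎

    entry≤∑∑ : ∀ {f : Matrix} → (∀ k p → 0# ≤ f k p) → ∀ k p → f k p ≤ ∑∑ f
    entry≤∑∑ {f} 0≤f k p = ≤-respˡ-≈ (∑∑-delta k p f) (∑∑-mono (λ k′ p′ →
      ≤-trans (only-≤ (does (k Fin.≟ k′)) (only-nonneg (does (p Fin.≟ p′)) (0≤f k′ p′)))
              (only-≤ (does (p Fin.≟ p′)) (0≤f k′ p′))))

    -- `parallelInequality` is applied on each core and summed over the cores. The squared core
    -- loads are then compared with the squared total by Cauchy-Schwarz at the price of a factor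
    -- `m`. The sum of squares splits over the cores exactly; it is enlarged by the same factor,
    -- using `1 ≤ m`, so that `ι m` can be taken out.
    coresInequality :
      ∀ {m} → 0 ℕ.< m → (core : Fin K → Fin N → Fin m) →
      ∀ (a C : Matrix) → (∀ k p → 0# ≤ a k p) →
      (∀ h k p → ∑∑ (λ k′ p′ → only (does (C k′ p′ ≤? C k p))
                                 (only (does (core k′ p′ Fin.≟ h)) (a k′ p′))) ≤ C k p) →
      let Y = ∑∑ (λ k p → a k p * C k p) in
      ∑∑ a * ∑∑ a + ∑∑ (λ k p → a k p * a k p) ≤ ι m * (Y + Y)
    coresInequality {m} 0<m core a C 0≤a volume = begin
      ∑∑ a * ∑∑ a + ∑∑ (λ k p → a k p * a k p)
        ≈⟨ +-cong (*-cong (split a) (split a)) (split _) ⟩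
      sum A * sum A + sum Q
        ≤⟨ +-mono-≤ ([∑]²≤n*∑² A) Q≤mQ ⟩
      ι m * ∑[ h < m ] (A h * A h) + ι m * sum Q
        ≈⟨ distribˡ _ _ _ ⟨
      ι m * (∑[ h < m ] (A h * A h) + sum Q)
        ≈⟨ *-congˡ (∑-distrib-+ {m} _ _) ⟨
      ι m * ∑[ h < m ] (A h * A h + Q h)
        ≤⟨ *-monoˡ-≤ (0≤ι m) (sum-mono perCore) ⟩
      ι m * ∑[ h < m ] (Y h + Y h)
        ≈⟨ *-congˡ (∑-distrib-+ {m} Y Y) ⟩
      ι m * (sum Y + sum Y)
        ≈⟨ *-congˡ (+-cong (split _) (split _)) ⟨
      ι m * (∑∑ (λ k p → a k p * C k p) + ∑∑ (λ k p → a k p * C k p)) ∎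
      where
      on : Fin m → Matrix → Matrix
      on h f k p = only (does (core k p Fin.≟ h)) (f k p)

      A Q Y : Fin m → Carrier
      A h = ∑∑ (on h a)
      Q h = ∑∑ (on h (λ k p → a k p * a k p))
      Y h = ∑∑ (on h (λ k p → a k p * C k p))

      -- Every entry lies on exactly one core.
      split : ∀ f → ∑∑ f ≈ ∑[ h < m ] ∑∑ (on h f)
      split f = begin-equality
        ∑∑ f                               ≈⟨ ∑∑-cong (λ k p → ∑-delta (core k p) (λ _ → f k p)) ⟨
        ∑∑ (λ k p → ∑[ h < m ] on h f k p)  ≈⟨ ∑∑-∑-comm {m} _ ⟩
        ∑[ h < m ] ∑∑ (on h f)              ∎

      Q≤mQ : sum Q ≤ ι m * sum Q
      Q≤mQ = begin
        sum Q        ≈⟨ *-identityˡ _ ⟨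
        1# * sum Q   ≈⟨ *-congʳ (+-identityʳ 1#) ⟨
        ι 1 * sum Q  ≤⟨ *-monoʳ-≤ (sum-nonneg (λ h → ∑∑-nonneg (λ k p →
                          only-nonneg (does (core k p Fin.≟ h)) (*-nonneg (0≤a k p) (0≤a k p)))))
                          (ι-mono-≤ 0<m) ⟩
        ι m * sum Q  ∎

      -- Restricting to core `h` amounts to giving weight `0#` to the entries on other cores, while
      -- `C` stays unrestricted.
      perCore : ∀ h → A h * A h + Q h ≤ Y h + Y h
      perCore h = begin
        A h * A h + Q h
          ≈⟨ +-congˡ (∑∑-cong (λ k p → only-square (does (core k p Fin.≟ h)))) ⟩
        A h * A h + ∑∑ (λ k p → on h a k p * on h a k p)
          ≤⟨ parallelInequality (on h a) C
               (λ k p → only-nonneg (does (core k p Fin.≟ h)) (0≤a k p)) (volume h) ⟩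
        ∑∑ (λ k p → on h a k p * C k p) + ∑∑ (λ k p → on h a k p * C k p)
          ≈⟨ +-cong (∑∑-cong (λ k p → only-* (does (core k p Fin.≟ h))))
                    (∑∑-cong (λ k p → only-* (does (core k p Fin.≟ h)))) ⟨
        Y h + Y h ∎

-- Feasible schedules yield feasible LP solutions.

module LowerBound {c ℓ₁ ℓ₂} (F : OrderedField c ℓ₁ ℓ₂) where
  open OrderedField F
  open OrderedFieldProperties F
  open CoflowScheduling F

  module _ {m N K : ℕ} (0<m : 0 ℕ.< m) (I : Instance N K) where
    open Instance I
    open Problem m I

    module _ (σ : Schedule) where
      open Schedule σ

      release≤completion : ∀ k → release k ≤ completion k
      release≤completion k = proj₁ (finished k)

      0≤completion : ∀ k → 0# ≤ completion k
      0≤completion k = ≤-trans (release≥0 k) (release≤completion k)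

      sentOn-nonneg : ∀ h f {s t} → s ≤ t → 0# ≤ sentOn h f s t
      sentOn-nonneg h f s≤t = only-nonneg (does (core f Fin.≟ h)) (x≤y⇒0≤y-x (sent-mono f s≤t))

      size≤sent-sent : ∀ f {k s t} → IsFlow f → coflow f ≡ k → s ≤ releaseOf f → completion k ≤ t →
                       size f ≤ sent f t - sent f s
      size≤sent-sent f {k} {s} {t} flow f∈k s≤r C≤t = x+z≤y⇒x≤y-z (begin
        size f + sent f s           ≈⟨ +-cong (sym (proj₂ (finished k) f flow f∈k)) (sent-release f s≤r) ⟩
        sent f (completion k) + 0#  ≈⟨ +-identityʳ _ ⟩
        sent f (completion k)       ≤⟨ sent-mono f C≤t ⟩
        sent f t                    ∎)

      -- The LP demands this for every triple. With zero demand it is the bound by the release.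
      -- Otherwise all data of `f` pass through its input port on one core between release and
      -- completion, and the capacity of that port bounds them by the length of the interval.
      release+size≤completion : ∀ f → releaseOf f + size f ≤ completion (coflow f)
      release+size≤completion f@(i , j , k) with demandOf f | size≤sent-sent f {s = release k}
      ... | zero  | _     = ≤-respˡ-≈ (sym (+-identityʳ _)) (release≤completion k)
      ... | suc d | size≤ = ≤-respˡ-≈ (+-comm _ _) (x≤y-z⇒x+z≤y (begin
        ι (suc d)
          ≤⟨ size≤ (ℕ.s≤s ℕ.z≤n) ≡.refl ≤-refl ≤-refl ⟩
        sent f (completion k) - sent f (release k)
          ≡⟨ only-yes (core f Fin.≟ core f) ≡.refl ⟨
        sentOn (core f) f (release k) (completion k)
          ≤⟨ entry≤∑∑ (λ j′ k′ → sentOn-nonneg (core f) (i , j′ , k′) (release≤completion k)) j k ⟩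
        ∑∑ (λ j′ k′ → sentOn (core f) (i , j′ , k′) (release k) (completion k))
          ≤⟨ inputCapacity (core f) i (release≤completion k) ⟩
        completion k - release k ∎))

      -- Treats input and output ports alike: `e k p` is the triple of coflow `k` joining the fixed
      -- port to the opposite port `p`, and `capacity` is the rate limit of the fixed port on one
      -- core, counted from time `0#`.
      portConstraints :
        ∀ (e : Fin K → Fin N → Triple) → (∀ k p → coflow (e k p) ≡ k) →
        (∀ h {t} → 0# ≤ t → ∑∑ (λ k p → sentOn h (e k p) 0# t) ≤ t) →
        PortConstraints (λ k p → demandOf (e k p)) (λ k p → completion k)
      portConstraints e coflow-e capacity S S⊆ =
        x≤y*z⇒y⁻¹*x≤z (0<ι (ℕ.≤-trans 0<m (ℕ.m≤m+n m _))) (begin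
          ∑∑ a * ∑∑ a + ∑∑ (λ k p → only (S k p) (size (e k p) * size (e k p)))
            ≈⟨ +-congˡ (∑∑-cong (λ k p → only-square (S k p))) ⟩
          ∑∑ a * ∑∑ a + ∑∑ (λ k p → a k p * a k p)
            ≤⟨ coresInequality 0<m (λ k p → core (e k p)) a (λ k p → completion k)
                 (λ k p → only-nonneg (S k p) (0≤ι (demandOf (e k p)))) volume ⟩
          ι m * (∑∑ (λ k p → a k p * completion k) + ∑∑ (λ k p → a k p * completion k))
            ≈⟨ ι[2m]*y≈ m _ ⟩
          ι (2 ℕ.* m) * ∑∑ (λ k p → a k p * completion k)
            ≈⟨ *-congˡ (∑∑-cong (λ k p → only-* (S k p))) ⟨
          ι (2 ℕ.* m) * ∑∑ (λ k p → only (S k p) (size (e k p) * completion k)) ∎)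
        where
        a : Fin K → Fin N → Carrier
        a k p = only (S k p) (size (e k p))

        -- Flows of `S` on core `h` whose coflow completes by `completion k` have sent nothing by
        -- time `0#`, as releases are non-negative, and everything by `completion k`. Their total
        -- size thus fits into that time.
        volume : ∀ h k (p : Fin N) →
          ∑∑ (λ k′ p′ → only (does (completion k′ ≤? completion k))
                          (only (does (core (e k′ p′) Fin.≟ h)) (a k′ p′))) ≤ completion k
        volume h k p = ≤-trans (∑∑-mono transmitted) (capacity h (0≤completion k))
          where
          transmitted : ∀ k′ p′ →
            only (does (completion k′ ≤? completion k)) (only (does (core (e k′ p′) Fin.≟ h)) (a k′ p′))
              ≤ sentOn h (e k′ p′) 0# (completion k)
          transmitted k′ p′ with completion k′ ≤? completion k | S k′ p′ in eq
          ... | no _    | _     = sentOn-nonneg h (e k′ p′) (0≤completion k)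
          ... | yes _   | false =
            ≤-respˡ-≈ (sym (only-zero (does (core (e k′ p′) Fin.≟ h))))
                      (sentOn-nonneg h (e k′ p′) (0≤completion k))
          ... | yes C≤C | true  = only-mono (does (core (e k′ p′) Fin.≟ h))
            (size≤sent-sent (e k′ p′) (S⊆ k′ p′ eq) (coflow-e k′ p′) (release≥0 _) C≤C)

      schedule-LPFeasible : LPFeasible completion (λ f → completion (coflow f))
      schedule-LPFeasible = record
        { coflow≥flow  = λ _ → ≤-refl
        ; flow≥release = release+size≤completion
        -- The capacity constraints sum over ports outside and coflows inside, the LP the other way
        -- round.
        ; inputs       = λ i → portConstraints (λ k j → i , j , k) (λ _ _ → ≡.refl) (λ h 0≤t →
            ≤-respˡ-≈ (∑-comm {N} {K} _) (≤-respʳ-≈ (x-0≈x _) (inputCapacity h i 0≤t)))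
        ; outputs      = λ j → portConstraints (λ k i → i , j , k) (λ _ _ → ≡.refl) (λ h 0≤t →
            ≤-respˡ-≈ (∑-comm {N} {K} _) (≤-respʳ-≈ (x-0≈x _) (outputCapacity h j 0≤t)))
        }
        where
        x-0≈x : ∀ x → x - 0# ≈ x
        x-0≈x x = trans (sym (+-identityʳ _)) (x-y+y≈x x 0#)

-- The list scheduling algorithm and its port loads.

module ListScheduling {c ℓ₁ ℓ₂} (F : OrderedField c ℓ₁ ℓ₂) where
  open OrderedField F
  open OrderedFieldProperties F
  open CoflowScheduling F

  module _ {m N K : ℕ} (I : Instance N K) where
    open Instance I
    open Problem m I

    -- With `x = size` this is the load assigned to a port of core `h`; with the remaining amounts
    -- it is the data still to be sent there.
    portLoad : (Triple → Fin N) → Fin N → (Triple → Fin m) → Fin m →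
               List Triple → (Triple → Carrier) → Carrier
    portLoad port q core h fs x =
      lsum fs (λ g → only (does (port g Fin.≟ q)) (only (does (core g Fin.≟ h)) (x g)))

    portTotal : (Triple → Fin N) → Fin N → List Triple → Carrier
    portTotal port q fs = lsum fs (λ g → only (does (port g Fin.≟ q)) (size g))

    -- Transmission on one core.

    module _ {order : List Triple} {core : Triple → Fin m} {h : Fin m} where
      open Transmission order core h

      admit-⊇ : ∀ A f {g} → g ∈ A → g ∈ admit A f
      admit-⊇ A f g∈A with all? (disjoint? f) A
      ... | yes _ = there g∈A
      ... | no  _ = g∈A

      admit-⊆ : ∀ A f {g} → g ∈ admit A f → g ≡ f ⊎ g ∈ A
      admit-⊆ A f g∈ with all? (disjoint? f) A | g∈
      ... | yes _ | here g≡f  = inj₁ g≡f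
      ... | yes _ | there g∈A = inj₂ g∈A
      ... | no  _ | g∈A       = inj₂ g∈A

      scan-⊇ : ∀ A fs {g} → g ∈ A → g ∈ foldl admit A fs
      scan-⊇ A []       g∈A = g∈A
      scan-⊇ A (f ∷ fs) g∈A = scan-⊇ (admit A f) fs (admit-⊇ A f g∈A)

      scan-⊆ : ∀ A fs {g} → g ∈ foldl admit A fs → g ∈ A ⊎ g ∈ fs
      scan-⊆ A []       g∈ = inj₁ g∈
      scan-⊆ A (f ∷ fs) g∈ with scan-⊆ (admit A f) fs g∈
      ... | inj₂ g∈fs = inj₂ (there g∈fs)
      ... | inj₁ g∈A′ with admit-⊆ A f g∈A′
      ...   | inj₁ g≡f = inj₂ (here g≡f)
      ...   | inj₂ g∈A = inj₁ g∈A

      Blocks : Triple → Triple → Set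
      Blocks g f = src g ≡ src f ⊎ dst g ≡ dst f

      ¬disjoint⇒blocks : ∀ f g → ¬ Disjoint f g → Blocks g f
      ¬disjoint⇒blocks f g ¬disj with src f Fin.≟ src g | dst f Fin.≟ dst g
      ... | yes p | _     = inj₁ (≡.sym p)
      ... | no _  | yes q = inj₂ (≡.sym q)
      ... | no ¬p | no ¬q = ⊥-elim (¬disj (¬p , ¬q))

      active⁻ : ∀ {t rem f} → f ∈ active t rem →
                f ∈ order × core f ≡ h × releaseOf f ≤ t × 0# < rem f
      active⁻ {t} {rem} f∈ with scan-⊆ [] (candidates t rem) f∈
      ... | inj₂ f∈cs = ∈-filter⁻ _ f∈cs

      active-or-blocked :
        ∀ {t rem f pre post} → order ≡ pre ++ f ∷ post →
        core f ≡ h → releaseOf f ≤ t → 0# < rem f →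
        f ∈ active t rem ⊎ ∃ λ g → g ∈ pre × g ∈ active t rem × Blocks g f
      active-or-blocked {t} {rem} {f} {pre} {post} order≡ f∈h r≤t 0<rem =
        ≡.subst (λ A → f ∈ A ⊎ ∃ λ g → g ∈ pre × g ∈ A × Blocks g f) (≡.sym active≡) scanned
        where
        Candidate? = λ g → (core g Fin.≟ h) ×-dec (releaseOf g ≤? t) ×-dec (0# <? rem g)
        earlier = foldl admit [] (filter Candidate? pre)
        later = filter Candidate? post

        active≡ : active t rem ≡ foldl admit (admit earlier f) later
        active≡ = ≡.trans
          (≡.cong (foldl admit []) (≡.trans (≡.cong (filter Candidate?) order≡)
            (≡.trans (List.filter-++ Candidate? pre (f ∷ post))
              (≡.cong (filter Candidate? pre ++_) (List.filter-accept Candidate? (f∈h , r≤t , 0<rem))))))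
          (List.foldl-++ admit [] (filter Candidate? pre) (f ∷ later))

        scanned : f ∈ foldl admit (admit earlier f) later ⊎
                  ∃ λ g → g ∈ pre × g ∈ foldl admit (admit earlier f) later × Blocks g f
        scanned with all? (disjoint? f) earlier
        ... | yes _ = inj₁ (scan-⊇ (f ∷ earlier) later (here ≡.refl))
        ... | no ¬all with find (All.¬All⇒Any¬ (disjoint? f) earlier ¬all)
        ...   | g , g∈earlier , ¬disj with scan-⊆ [] (filter Candidate? pre) g∈earlier
        ...     | inj₂ g∈cs = inj₂ (g , proj₁ (∈-filter⁻ Candidate? g∈cs) ,
                                    scan-⊇ earlier later g∈earlier , ¬disjoint⇒blocks f g ¬disj)

      advance-≤ : ∀ t rem {t′} → t ≤ t′ → ∀ f → advance t rem t′ f ≤ rem f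
      advance-≤ t rem t≤t′ f with any? (f ≟ᵗ_) (active t rem)
      ... | yes _ = x-y≤x (x≤y⇒0≤y-x t≤t′)
      ... | no  _ = ≤-refl

      advance-active : ∀ t rem t′ {f} → f ∈ active t rem →
                       advance t rem t′ f + (t′ - t) ≤ rem f
      advance-active t rem t′ {f} f∈ with any? (f ≟ᵗ_) (active t rem)
      ... | yes _ = ≤-reflexive (x-y+y≈x (rem f) (t′ - t))
      ... | no f∉ = ⊥-elim (f∉ f∈)

      -- The completion of an active flow is itself an event, strictly after `t` because the flow
      -- has data left. The next event is therefore no later, and no active flow sends more than it
      -- has.
      advance-nonneg : ∀ {t rem t′} → NextEvent t rem t′ → (∀ f → 0# ≤ rem f) →
                       ∀ f → 0# ≤ advance t rem t′ f
      advance-nonneg {t} {rem} {t′} (_ , first) 0≤rem f with any? (f ≟ᵗ_) (active t rem)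
      ... | no _   = 0≤rem f
      ... | yes f∈ = x≤y⇒0≤y-x (+-cancelʳ-≤ t (begin
        t′ - t + t  ≈⟨ x-y+y≈x t′ t ⟩
        t′          ≤⟨ first (t + rem f) ((x≤x+y (0≤rem f) , t≉t+rem) , inj₂ (f , f∈ , refl)) ⟩
        t + rem f   ≈⟨ +-comm t (rem f) ⟩
        rem f + t   ∎))
        where
        0<rem : 0# < rem f
        0<rem = proj₂ (proj₂ (proj₂ (active⁻ f∈)))
        t≉t+rem : ¬ t ≈ t + rem f
        t≉t+rem t≈ = ≤∧≉⇒≰ 0<rem (+-cancelʳ-≤ t (begin
          rem f + t  ≈⟨ +-comm (rem f) t ⟩
          t + rem f  ≈⟨ t≈ ⟨
          t          ≈⟨ +-identityˡ t ⟨
          0# + t     ∎))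

      module _ {f : Triple} {pre post : List Triple}
               (order≡ : order ≡ pre ++ f ∷ post) (f∈h : core f ≡ h) where

        -- A potential: the unsent data of earlier flows on the two ports of `f`, plus those of `f`.
        -- A flow sharing both ports is counted twice.
        work : Remaining → Carrier
        work rem = portLoad src (src f) core h pre rem + portLoad dst (dst f) core h pre rem + rem f

        f∈order : f ∈ order
        f∈order = ≡.subst (f ∈_) (≡.sym order≡) (∈-++⁺ʳ pre (here ≡.refl))

        portLoad-mono : ∀ port q {x y : Remaining} → (∀ g → x g ≤ y g) →
                        portLoad port q core h pre x ≤ portLoad port q core h pre y
        portLoad-mono port q x≤y = lsum-mono pre (λ g →
          only-mono (does (port g Fin.≟ q)) (only-mono (does (core g Fin.≟ h)) (x≤y g)))

        portLoad-nonneg : ∀ port q {x : Remaining} → (∀ g → 0# ≤ x g) → 0# ≤ portLoad port q core h pre x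
        portLoad-nonneg port q 0≤x = lsum-nonneg pre (λ g →
          only-nonneg (does (port g Fin.≟ q)) (only-nonneg (does (core g Fin.≟ h)) (0≤x g)))

        work-mono : ∀ {x y : Remaining} → (∀ g → x g ≤ y g) → work x ≤ work y
        work-mono x≤y = +-mono-≤ (+-mono-≤ (portLoad-mono src _ x≤y) (portLoad-mono dst _ x≤y)) (x≤y f)

        work-nonneg : ∀ {x : Remaining} → (∀ g → 0# ≤ x g) → 0# ≤ work x
        work-nonneg 0≤x = +-nonneg (+-nonneg (portLoad-nonneg src _ 0≤x) (portLoad-nonneg dst _ 0≤x)) (0≤x f)

        portLoad-drop : ∀ port {q g z} {x y : Remaining} → g ∈ pre → port g ≡ q → core g ≡ h →
                        x g + z ≤ y g → (∀ g → x g ≤ y g) →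
                        portLoad port q core h pre x + z ≤ portLoad port q core h pre y
        portLoad-drop port {q} {g} {z} {x} {y} g∈pre g∈q g∈h drop x≤y = lsum-drop g∈pre
          (≡.subst₂ (λ a b → a + z ≤ b) (≡.sym (both x)) (≡.sym (both y)) drop)
          (λ g → only-mono (does (port g Fin.≟ q)) (only-mono (does (core g Fin.≟ h)) (x≤y g)))
          where
          both : ∀ x → only (does (port g Fin.≟ q)) (only (does (core g Fin.≟ h)) (x g)) ≡ x g
          both x = ≡.trans (only-yes (port g Fin.≟ q) g∈q) (only-yes (core g Fin.≟ h) g∈h)

        -- While f is released and unfinished, f itself or an earlier flow that
        -- shares a port with it is being transmitted.
        work-drop : ∀ {t rem t′} → t ≤ t′ → releaseOf f ≤ t → 0# < rem f →
                    work (advance t rem t′) + (t′ - t) ≤ work rem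
        work-drop {t} {rem} {t′} t≤t′ r≤t 0<rem = cases (active-or-blocked order≡ f∈h r≤t 0<rem)
          where
          adv≤ = advance-≤ t rem t≤t′

          blocker-drop : ∀ port {q g} → g ∈ pre → g ∈ active t rem → port g ≡ q →
            portLoad port q core h pre (advance t rem t′) + (t′ - t) ≤ portLoad port q core h pre rem
          blocker-drop port g∈pre g∈ g∈q =
            portLoad-drop port g∈pre g∈q (proj₁ (proj₂ (active⁻ g∈))) (advance-active t rem t′ g∈) adv≤

          cases : f ∈ active t rem ⊎ (∃ λ g → g ∈ pre × g ∈ active t rem × Blocks g f) →
                  work (advance t rem t′) + (t′ - t) ≤ work rem
          cases (inj₁ f∈) = ≤-respˡ-≈ (sym (+-assoc _ _ _))
            (+-mono-≤ (+-mono-≤ (portLoad-mono src _ adv≤) (portLoad-mono dst _ adv≤))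
                      (advance-active t rem t′ f∈))
          cases (inj₂ (g , g∈pre , g∈ , inj₁ g∈src)) = ≤-respˡ-≈
            (solve 4 (λ a b d z → a :+ z :+ b :+ d := a :+ b :+ d :+ z) refl _ _ _ _)
            (+-mono-≤ (+-mono-≤ (blocker-drop src g∈pre g∈ g∈src) (portLoad-mono dst _ adv≤)) (adv≤ f))
          cases (inj₂ (g , g∈pre , g∈ , inj₂ g∈dst)) = ≤-respˡ-≈
            (solve 4 (λ a b d z → a :+ (b :+ z) :+ d := a :+ b :+ d :+ z) refl _ _ _ _)
            (+-mono-≤ (+-mono-≤ (portLoad-mono src _ adv≤) (blocker-drop dst g∈pre g∈ g∈dst)) (adv≤ f))

        -- `R` bounds both the current time and the release of `f`, and `R + work rem` never
        -- increases from event to event. Before the release `R` is kept and the work can only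
        -- shrink. After it `R` grows by the length of the step, and by `work-drop` the work falls
        -- by at least as much.
        finishTime≤ : ∀ {t rem R} (run : Run t rem) → (∀ g → 0# ≤ rem g) →
                      t ≤ R → releaseOf f ≤ R → finishTime run f ≤ R + work rem
        finishTime≤ (done _) 0≤rem t≤R r≤R = ≤-trans t≤R (x≤x+y (work-nonneg 0≤rem))
        finishTime≤ {t} {rem} {R} (next t′ event@((t<t′ , _) , first) run) 0≤rem t≤R r≤R
          with rem f ≟ 0#
        ... | yes _ = ≤-trans t≤R (x≤x+y (work-nonneg 0≤rem))
        ... | no rem≉0 with releaseOf f ≤? t
        ...   | yes r≤t = begin
          finishTime run f
            ≤⟨ finishTime≤ run 0≤rem′ t′≤R+ (≤-trans r≤R (x≤x+y (x≤y⇒0≤y-x t≤t′))) ⟩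
          R + (t′ - t) + work (advance t rem t′)
            ≈⟨ solve 3 (λ R d w → R :+ d :+ w := R :+ (w :+ d)) refl _ _ _ ⟩
          R + (work (advance t rem t′) + (t′ - t))
            ≤⟨ +-monoʳ-≤ R (work-drop t≤t′ r≤t (0≤rem f , rem≉0 ∘ sym)) ⟩
          R + work rem ∎
          where
          0≤rem′ = advance-nonneg event 0≤rem
          t≤t′ = proj₁ t<t′
          t′≤R+ : t′ ≤ R + (t′ - t)
          t′≤R+ = ≤-respˡ-≈ (y+[x-y]≈x t′ t) (+-monoˡ-≤ (t′ - t) t≤R)
        ...   | no r≰t = ≤-trans (finishTime≤ run (advance-nonneg event 0≤rem) (≤-trans t′≤r r≤R) r≤R)
          (+-monoʳ-≤ R (work-mono (advance-≤ t rem (proj₁ t<t′))))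
          where
          -- The release of `f` is an event, so no step jumps over it.
          t′≤r : t′ ≤ releaseOf f
          t′≤r = first (releaseOf f) (≰⇒< r≰t , inj₁ (f , (f∈order , f∈h) , refl))

    -- Greedy assignment.

    module _ {core : Triple → Fin m} where

      increase-ι : ∀ load p h₀ d q h →
        ι (increase load p h₀ d q h) ≈
        ι (load q h) + only (does (p Fin.≟ q)) (only (does (h₀ Fin.≟ h)) (ι d))
      increase-ι load p h₀ d q h with p Fin.≟ q
      ... | no p≢q
        rewrite updateAt-minimal q p {λ row → updateAt row h₀ (ℕ._+ d)} load (p≢q ∘ ≡.sym) = sym (+-identityʳ _)
      ... | yes ≡.refl
        rewrite updateAt-updates q {λ row → updateAt row h₀ (ℕ._+ d)} load with h₀ Fin.≟ h
      ...   | no h₀≢h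
        rewrite updateAt-minimal h h₀ {ℕ._+ d} (load q) (h₀≢h ∘ ≡.sym) = sym (+-identityʳ _)
      ...   | yes ≡.refl
        rewrite updateAt-updates h {ℕ._+ d} (load q) = ι-+ (load q h) d

      loadAfter : Load → (Triple → Fin N) → List Triple → Fin N → Fin m → Carrier
      loadAfter load port fs q h = ι (load q h) + portLoad port q core h fs size

      loadAfter-∷ : ∀ load port g fs q h →
        loadAfter (increase load (port g) (core g) (demandOf g)) port fs q h ≈
        loadAfter load port (g ∷ fs) q h
      loadAfter-∷ load port g fs q h =
        trans (+-congʳ (increase-ι load (port g) (core g) (demandOf g) q h)) (+-assoc _ _ _)

      -- The starting loads are arbitrary so that the induction can move the head of `pre` from the
      -- list into the load tables. With `pre` empty the tables are those seen by `f`.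
      greedyFrom-minimal :
        ∀ loadI loadO pre {f post} → GreedyFrom loadI loadO (pre ++ f ∷ post) core → ∀ h →
        loadAfter loadI src pre (src f) (core f) + loadAfter loadO dst pre (dst f) (core f) ≤
        loadAfter loadI src pre (src f) h + loadAfter loadO dst pre (dst f) h
      greedyFrom-minimal loadI loadO [] {f} (minimal , _) h =
        ≤-respˡ-≈ (ι-sum (core f)) (≤-respʳ-≈ (ι-sum h) (ι-mono-≤ (minimal h)))
        where
        ι-sum : ∀ h → ι (loadI (src f) h ℕ.+ loadO (dst f) h) ≈
                      loadAfter loadI src [] (src f) h + loadAfter loadO dst [] (dst f) h
        ι-sum h = trans (ι-+ (loadI (src f) h) _) (sym (+-cong (+-identityʳ _) (+-identityʳ _)))
      greedyFrom-minimal loadI loadO (g ∷ pre) {f} (_ , greedy) h =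
        ≤-respˡ-≈ (both (core f)) (≤-respʳ-≈ (both h) (greedyFrom-minimal _ _ pre greedy h))
        where
        both = λ h → +-cong (loadAfter-∷ loadI src g pre (src f) h) (loadAfter-∷ loadO dst g pre (dst f) h)

      ∑-portLoad : ∀ port q fs → ∑[ h < m ] portLoad port q core h fs size ≈ portTotal port q fs
      ∑-portLoad port q []       = sum-replicate-zero m
      ∑-portLoad port q (g ∷ fs) = trans (∑-distrib-+ {m} _ _) (+-cong split (∑-portLoad port q fs))
        where
        split : ∑[ h < m ] (only (does (port g Fin.≟ q)) (only (does (core g Fin.≟ h)) (size g))) ≈
                only (does (port g Fin.≟ q)) (size g)
        split with does (port g Fin.≟ q)
        ... | true  = ∑-delta (core g) (λ _ → size g)
        ... | false = sum-replicate-zero m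

      -- The minimum over the `m` cores is at most the average, and summing over the cores recovers
      -- the port totals.
      greedy-average : ∀ pre {f post} → Greedy (pre ++ f ∷ post) core →
        ι m * (portLoad src (src f) core (core f) pre size + portLoad dst (dst f) core (core f) pre size) ≤
        portTotal src (src f) pre + portTotal dst (dst f) pre
      greedy-average pre {f} greedy = begin
        ι m * loads (core f)
          ≈⟨ ∑-const m _ ⟨
        ∑[ h < m ] loads (core f)
          ≤⟨ sum-mono minimal ⟩
        ∑[ h < m ] loads h
          ≈⟨ ∑-distrib-+ {m} _ _ ⟩
        ∑[ h < m ] portLoad src (src f) core h pre size + ∑[ h < m ] portLoad dst (dst f) core h pre size
          ≈⟨ +-cong (∑-portLoad src (src f) pre) (∑-portLoad dst (dst f) pre) ⟩
        portTotal src (src f) pre + portTotal dst (dst f) pre ∎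
        where
        loads : Fin m → Carrier
        loads h = portLoad src (src f) core h pre size + portLoad dst (dst f) core h pre size
        0+ : ∀ h → loadAfter (λ _ _ → 0) src pre (src f) h + loadAfter (λ _ _ → 0) dst pre (dst f) h ≈ loads h
        0+ h = +-cong (+-identityˡ _) (+-identityˡ _)
        minimal : ∀ h → loads (core f) ≤ loads h
        minimal h = ≤-respˡ-≈ (0+ (core f)) (≤-respʳ-≈ (0+ h) (greedyFrom-minimal _ _ pre greedy h))

    -- The LP bound on the total size at one port.

    module _ (port : Triple → Fin N) (q : Fin N) (e : Fin K → Fin N → Triple)
             (e-onto : ∀ f → port f ≡ q → ∃₂ λ k p → e k p ≡ f) where

      members : List Triple → Fin K → Fin N → Bool
      members fs k p = does (any? (e k p ≟ᵗ_) fs)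

      membersTotal : List Triple → Carrier
      membersTotal fs = ∑∑ (λ k p → only (members fs k p) (size (e k p)))

      -- Turns a sum over a list into a sum over the index pairs used by the LP. By `e-onto` every
      -- listed flow on the port has a pair, and by uniqueness no pair has to account for two list
      -- entries.
      portTotal≤ : ∀ fs → Unique fs → portTotal port q fs ≤ membersTotal fs
      portTotal≤ []       _            = ∑∑-nonneg {K} {N} {λ _ _ → 0#} (λ _ _ → ≤-refl)
      portTotal≤ (f ∷ fs) (f∉ ∷ unique) with port f Fin.≟ q
      ... | no _ = ≤-respˡ-≈ (sym (+-identityˡ _)) (≤-trans (portTotal≤ fs unique) (∑∑-mono grow))
        where
        grow : ∀ k p → only (members fs k p) (size (e k p)) ≤ only (members (f ∷ fs) k p) (size (e k p))
        grow k p = only-⇒ (any? (e k p ≟ᵗ_) fs) (any? (e k p ≟ᵗ_) (f ∷ fs)) there (0≤ι (demandOf (e k p)))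
      ... | yes f∈q with e-onto f f∈q
      ...   | k₀ , p₀ , ≡.refl = begin
        size f + portTotal port q fs
          ≤⟨ +-monoʳ-≤ (size f) (portTotal≤ fs unique) ⟩
        size f + membersTotal fs
          ≈⟨ +-congʳ (∑∑-delta k₀ p₀ (λ k p → size (e k p))) ⟨
        ∑∑ new + membersTotal fs
          ≈⟨ ∑∑-distrib-+ new _ ⟨
        ∑∑ (λ k p → new k p + only (members fs k p) (size (e k p)))
          ≤⟨ ∑∑-mono add ⟩
        membersTotal (f ∷ fs) ∎
        where
        new : Fin K → Fin N → Carrier
        new k p = only (does (k₀ Fin.≟ k)) (only (does (p₀ Fin.≟ p)) (size (e k p)))
        add : ∀ k p → new k p + only (members fs k p) (size (e k p)) ≤
                      only (members (f ∷ fs) k p) (size (e k p))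
        add k p = only-⊎ (k₀ Fin.≟ k) (p₀ Fin.≟ p) (any? (e k p ≟ᵗ_) fs) (any? (e k p ≟ᵗ_) (f ∷ fs))
          (λ { ≡.refl ≡.refl ∈fs → All.lookup f∉ ∈fs ≡.refl }) (λ { ≡.refl ≡.refl → here ≡.refl }) there
          (0≤ι (demandOf (e k p)))

      -- With `D` the total size, the LP constraint for the set `fs` and the bound `B` on its
      -- variables give `D * D ≤ ι (2 ℕ.* m) * (D * B)`; then one factor `D` is cancelled.
      membersTotal≤ : ∀ {Cᶠ : Triple → Carrier} {B} fs → 0 ℕ.< m → 0# ≤ B →
        (∀ {g} → g ∈ fs → IsFlow g × Cᶠ g ≤ B) →
        PortConstraints (λ k p → demandOf (e k p)) (λ k p → Cᶠ (e k p)) →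
        membersTotal fs ≤ ι (2 ℕ.* m) * B
      membersTotal≤ {Cᶠ} {B} fs 0<m 0≤B fs≤B constraint = cancel (0# <? D)
        where
        D = membersTotal fs
        0<2m = 0<ι (ℕ.≤-trans 0<m (ℕ.m≤m+n m _))

        member : ∀ k p → members fs k p ≡ true → e k p ∈ fs
        member k p eq = does-true (any? (e k p ≟ᵗ_) fs) eq

        late : ∀ k p → only (members fs k p) (size (e k p) * Cᶠ (e k p)) ≤
                       only (members fs k p) (size (e k p)) * B
        late k p with members fs k p in eq
        ... | true  = *-monoˡ-≤ (0≤ι (demandOf (e k p))) (proj₂ (fs≤B (member k p eq)))
        ... | false = ≤-reflexive (sym (zeroˡ B))

        D*D≤ : D * D ≤ D * (ι (2 ℕ.* m) * B)
        D*D≤ = begin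
          D * D
            ≤⟨ x≤x+y (∑∑-nonneg (λ k p → only-nonneg (members fs k p)
                 (*-nonneg (0≤ι (demandOf (e k p))) (0≤ι (demandOf (e k p)))))) ⟩
          D * D + ∑∑ (λ k p → only (members fs k p) (size (e k p) * size (e k p)))
            ≤⟨ y⁻¹*x≤z⇒x≤y*z 0<2m (constraint (members fs) (λ k p eq → proj₁ (fs≤B (member k p eq)))) ⟩
          ι (2 ℕ.* m) * ∑∑ (λ k p → only (members fs k p) (size (e k p) * Cᶠ (e k p)))
            ≤⟨ *-monoˡ-≤ (proj₁ 0<2m) (∑∑-mono late) ⟩
          ι (2 ℕ.* m) * ∑∑ (λ k p → only (members fs k p) (size (e k p)) * B)
            ≈⟨ *-congˡ (*-distribʳ-∑∑ B (λ k p → only (members fs k p) (size (e k p)))) ⟨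
          ι (2 ℕ.* m) * (D * B)
            ≈⟨ solve 3 (λ a D B → a :* (D :* B) := D :* (a :* B)) refl _ D B ⟩
          D * (ι (2 ℕ.* m) * B) ∎

        -- Cancelling requires `D` positive; otherwise `D ≤ 0#` and the right side is non-negative.
        cancel : Dec (0# < D) → D ≤ ι (2 ℕ.* m) * B
        cancel (yes 0<D) = *-cancelˡ-≤ 0<D D*D≤
        cancel (no 0≮D)  with D ≤? 0#
        ... | yes D≤0 = ≤-trans D≤0 (*-nonneg (proj₁ 0<2m) 0≤B)
        ... | no D≰0  = ⊥-elim (0≮D (≰⇒< D≰0))

-- The approximation ratio.

module ApproximationRatio {c ℓ₁ ℓ₂} (F : OrderedField c ℓ₁ ℓ₂) where
  open OrderedField F
  open OrderedFieldProperties F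
  open CoflowScheduling F
  open LowerBound F
  open ListScheduling F

  ratio : ℕ → Carrier
  ratio m = ι 6 - ι 2 * ι m ⁻¹

  5≤ratio : ∀ {m} → 2 ℕ.≤ m → ι 5 ≤ ratio m
  5≤ratio {m} 2≤m = x+z≤y⇒x≤y-z (begin
    ι 5 + ι 2 * ι m ⁻¹  ≤⟨ +-monoʳ-≤ (ι 5) 2/m≤1 ⟩
    ι 5 + 1#            ≈⟨ +-comm (ι 5) 1# ⟩
    ι 6                 ∎)
    where
    2/m≤1 : ι 2 * ι m ⁻¹ ≤ 1#
    2/m≤1 = ≤-respˡ-≈ (*-comm _ _) (x≤y*z⇒y⁻¹*x≤z (0<ι (ℕ.≤-trans (ℕ.s≤s ℕ.z≤n) 2≤m))
      (≤-respʳ-≈ (sym (*-identityʳ (ι m))) (ι-mono-≤ 2≤m)))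

  module _ {m N K : ℕ} (2≤m : 2 ℕ.≤ m) (I : Instance N K) where
    open Instance I
    open Problem m I

    0<m : 0 ℕ.< m
    0<m = ℕ.≤-trans (ℕ.s≤s ℕ.z≤n) 2≤m

    0≤ratio : 0# ≤ ratio m
    0≤ratio = ≤-trans (0≤ι 5) (5≤ratio 2≤m)

    -- Needed for the release time, the base value of the maximum in `completion`.
    x≤ratio*x : ∀ {x} → 0# ≤ x → x ≤ ratio m * x
    x≤ratio*x {x} 0≤x = begin
      x            ≈⟨ *-identityˡ x ⟨
      -- `ι 5` unfolds to `1# + ι 4`.
      1# * x       ≤⟨ *-monoʳ-≤ 0≤x (x≤x+y (0≤ι 4)) ⟩
      ι 5 * x      ≤⟨ *-monoʳ-≤ 0≤x (5≤ratio 2≤m) ⟩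
      ratio m * x  ∎

    weightedSum-mono : ∀ {C D} → (∀ k → C k ≤ D k) → weightedSum C ≤ weightedSum D
    weightedSum-mono C≤D = sum-mono (λ k → *-monoˡ-≤ (proj₁ (weight>0 k)) (C≤D k))

    weightedSum-*ˡ : ∀ x C → weightedSum (λ k → x * C k) ≈ x * weightedSum C
    weightedSum-*ˡ x C = trans
      (sum-cong-≋ {K} (λ k → solve 3 (λ w x C → w :* (x :* C) := x :* (w :* C)) refl (weight k) x (C k)))
      (sym (*-distribˡ-sum {K} x _))

    module _ (alg : Execution) where
      open Execution alg
      open LPOptimal lpOptimal
      open LPFeasible feasible

      0≤lpCᶠ : ∀ f → 0# ≤ lpCᶠ f
      0≤lpCᶠ f = ≤-trans (+-nonneg (release≥0 (coflow f)) (0≤ι (demandOf f))) (flow≥release f)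

      -- The list is sorted by LP value, so `lpCᶠ f` can serve as the bound `B` of `membersTotal≤`
      -- for all flows of `pre`, at either port.
      portTotal≤lp : ∀ {f pre post} → order ≡ pre ++ f ∷ post →
                     portTotal {m} I src (src f) pre ≤ ι (2 ℕ.* m) * lpCᶠ f ×
                     portTotal {m} I dst (dst f) pre ≤ ι (2 ℕ.* m) * lpCᶠ f
      portTotal≤lp {f} {pre} {post} order≡ =
        ≤-trans (portTotal≤ {m} I src (src f) fromInput fromInput-onto pre unique′)
                (membersTotal≤ I src (src f) fromInput fromInput-onto pre 0<m (0≤lpCᶠ f) earlier
                  (inputs (src f))) ,
        ≤-trans (portTotal≤ {m} I dst (dst f) toOutput toOutput-onto pre unique′)
                (membersTotal≤ I dst (dst f) toOutput toOutput-onto pre 0<m (0≤lpCᶠ f) earlier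
                  (outputs (dst f)))
        where
        fromInput toOutput : Fin K → Fin N → Triple
        fromInput k j = src f , j , k
        toOutput  k i = i , dst f , k
        fromInput-onto : ∀ g → src g ≡ src f → ∃₂ λ k j → fromInput k j ≡ g
        fromInput-onto (_ , j , k) ≡.refl = k , j , ≡.refl
        toOutput-onto : ∀ g → dst g ≡ dst f → ∃₂ λ k i → toOutput k i ≡ g
        toOutput-onto (i , _ , k) ≡.refl = k , i , ≡.refl
        unique′ : Unique pre
        unique′ = AllPairs-++⁻ˡ pre (≡.subst Unique order≡ unique)
        earlier : ∀ {g} → g ∈ pre → IsFlow g × lpCᶠ g ≤ lpCᶠ f
        earlier g∈pre =
          Equivalence.to (complete _) (≡.subst (_ ∈_) (≡.sym order≡) (∈-++⁺ˡ g∈pre)) ,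
          AllPairs-++⁻ pre (≡.subst (AllPairs _) order≡ sorted) g∈pre (here ≡.refl)

      flowCompletion≤ : ∀ {f} → f ∈ order → flowCompletion f ≤ ι 5 * lpCᶠ f
      flowCompletion≤ {f} f∈order with ∈-∃++ f∈order
      ... | pre , post , order≡ = begin
        flowCompletion f
          -- Here `R` is the release of `f`; the run starts at `0#` with all sizes unsent.
          ≤⟨ finishTime≤ I order≡ ≡.refl (run (core f)) (λ g → 0≤ι (demandOf g))
               (release≥0 (coflow f)) ≤-refl ⟩
        releaseOf f + (loads + size f)
          ≈⟨ solve 3 (λ r l s → r :+ (l :+ s) := l :+ (r :+ s)) refl (releaseOf f) loads (size f) ⟩
        loads + (releaseOf f + size f)
          -- Each of the two ports contributes `y + y`, which is the LP bound `2m y` divided by `m`;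
          -- release plus size contributes the fifth `y`.
          ≤⟨ +-mono-≤ loads≤ (flow≥release f) ⟩
        (y + y) + (y + y) + y
          ≈⟨ solve 1 (λ y → (y :+ y) :+ (y :+ y) :+ y :=
               (con 1 :+ (con 1 :+ (con 1 :+ (con 1 :+ (con 1 :+ con 0))))) :* y) refl y ⟩
        ι 5 * y ∎
        where
        y = lpCᶠ f
        loads = portLoad I src (src f) core (core f) pre size +
                portLoad I dst (dst f) core (core f) pre size
        loads≤ : loads ≤ (y + y) + (y + y)
        loads≤ = *-cancelˡ-≤ (0<ι 0<m) (begin
          ι m * loads
            ≤⟨ greedy-average I pre (≡.subst (λ fs → Greedy fs core) order≡ greedy) ⟩
          portTotal {m} I src (src f) pre + portTotal {m} I dst (dst f) pre
            ≤⟨ +-mono-≤ (proj₁ (portTotal≤lp order≡)) (proj₂ (portTotal≤lp order≡)) ⟩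
          ι (2 ℕ.* m) * y + ι (2 ℕ.* m) * y
            ≈⟨ +-cong (ι[2m]*y≈ m y) (ι[2m]*y≈ m y) ⟨
          ι m * (y + y) + ι m * (y + y)
            ≈⟨ distribˡ _ _ _ ⟨
          ι m * ((y + y) + (y + y)) ∎)

      -- `B` is left open so that it can be the LP value of the coflow or its completion time in a
      -- given schedule.
      completion≤ : ∀ {k B} → 0# ≤ B → release k ≤ B →
                    (∀ f → IsFlow f → coflow f ≡ k → lpCᶠ f ≤ B) →
                    completion k ≤ ratio m * B
      completion≤ {k} {B} 0≤B r≤B lp≤B = max≤v⁺ (≤-trans r≤B (x≤ratio*x 0≤B))
        (All.map⁺ (All.tabulate flow≤))
        where
        flow≤ : ∀ {f} → f ∈ filter (λ f → coflow f Fin.≟ k) order → flowCompletion f ≤ ratio m * B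
        flow≤ {f} f∈ with ∈-filter⁻ (λ f → coflow f Fin.≟ k) f∈
        ... | f∈order , f∈k = begin
          flowCompletion f  ≤⟨ flowCompletion≤ f∈order ⟩
          ι 5 * lpCᶠ f      ≤⟨ *-monoˡ-≤ (0≤ι 5) (lp≤B f (Equivalence.to (complete f) f∈order) f∈k) ⟩
          ι 5 * B           ≤⟨ *-monoʳ-≤ 0≤B (5≤ratio 2≤m) ⟩
          ratio m * B       ∎

      cost≤ : ∀ {B} → (∀ k → completion k ≤ ratio m * B k) → cost ≤ ratio m * weightedSum B
      cost≤ {B} C≤ = ≤-respʳ-≈ (weightedSum-*ˡ (ratio m) B) (weightedSum-mono C≤)

  -- Without ports the LP has no constraints, so there the completion times are
  -- compared with those of σ directly.
  approximation : ∀ {m} → 2 ℕ.≤ m → ∀ {N K} (I : Instance N K) →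
                  let open Problem m I in
                  ∀ (alg : Execution) (σ : Schedule) → Execution.cost alg ≤ ratio m * Schedule.cost σ
  approximation {m} 2≤m {zero} I alg σ = cost≤ 2≤m I alg (λ k →
    completion≤ 2≤m I alg (0≤completion (0<m 2≤m I) I σ k) (release≤completion (0<m 2≤m I) I σ k)
      (λ { (() , _) }))
  approximation {m} 2≤m {suc N} I alg σ = begin
    Execution.cost alg
      ≤⟨ cost≤ 2≤m I alg (λ k → completion≤ 2≤m I alg
           (≤-trans (release≥0 k) (release≤lpC k)) (release≤lpC k) (λ { f _ ≡.refl → coflow≥flow f })) ⟩
    ratio m * weightedSum lpC
      ≤⟨ *-monoˡ-≤ (0≤ratio 2≤m I) (minimal _ _ (schedule-LPFeasible (0<m 2≤m I) I σ)) ⟩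
    ratio m * Schedule.cost σ ∎
    where
    open Instance I
    open Problem m I
    open Execution alg using (lpC; lpCᶠ; lpOptimal)
    open LPOptimal lpOptimal
    open LPFeasible feasible
    -- A coflow may have no flows, but as soon as there is a port the LP constrains the triple `f`
    -- below, whatever its demand.
    release≤lpC : ∀ k → release k ≤ lpC k
    release≤lpC k = ≤-trans (x≤x+y (0≤ι (demandOf f))) (≤-trans (flow≥release f) (coflow≥flow f))
      where
      f = zero , zero , k

theorem3p4 : ∀ {c ℓ₁ ℓ₂} (F : OrderedField c ℓ₁ ℓ₂) →
    let open OrderedField F
        open CoflowScheduling F in
    ∀ (m : ℕ) → 2 ℕ.≤ m → ∀ {N K : ℕ} (I : Instance N K) →
    let open Problem m I in
    ∀ (alg : Execution) (σ : Schedule) →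
    Execution.cost alg ≤ (ι 6 - ι 2 * ι m ⁻¹) * Schedule.cost σ
theorem3p4 F m 2≤m I alg σ = ApproximationRatio.approximation F 2≤m I alg σ
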